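{- $14.12\le L(12453)\le 14.66$. In particular, $L(12453)$ is not an integer.
   Context: A permutation $p=p_1\cdots p_n$ of $[n]$ contains a pattern $q=q_1\cdots q_k$ (a permutation of $[k]$) if there are indices $i_1<\dots<i_k$ with $p_{i_a}<p_{i_b}$ iff $q_a<q_b$; otherwise $p$ avoids $q$. $S_n(q)$ is the number of permutations of length $n$ avoiding $q$, and $L(q)=\lim_{n\to\infty}\sqrt[n]{S_n(q)}$ (this limit is known to exist for every pattern $q$). -}

module Defs where

open import Data.Nat using (ℕ; zero; suc; _+_; _*_; _^_; _≤_; _<_; _<ᵇ_; _≡ᵇ_)
open import Data.Bool using (Bool; true; false; _∧_; _∨_; not; if_then_else_)
open import Data.List using (List; []; _∷_; map; concatMap; filter; length; zip; all; any; upTo)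
open import Data.Product using (_×_; _,_)
open import Relation.Nullary.Decidable using (Dec; yes; no)
open import Data.Bool using (T)
open import Data.Bool.Properties using (T?)

words : ℕ → ℕ → List (List ℕ)
words k zero    = [] ∷ []
words k (suc m) = concatMap (λ w → map (λ a → suc a ∷ w) (upTo k)) (words k m)

distinct : List ℕ → Bool
distinct []       = true
distinct (x ∷ xs) = not (any (λ y → x ≡ᵇ y) xs) ∧ distinct xs

perms : ℕ → List (List ℕ)
perms n = filter (λ w → T? (distinct w)) (words n n)

subseqs : ℕ → List ℕ → List (List ℕ)
subseqs zero    _        = [] ∷ []
subseqs (suc k) []       = []
subseqs (suc k) (x ∷ xs) = map (x ∷_) (subseqs k xs) ++' subseqs (suc k) xs
  where
  _++'_ : List (List ℕ) → List (List ℕ) → List (List ℕ)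
  [] ++' ys = ys
  (z ∷ zs) ++' ys = z ∷ (zs ++' ys)

orderIso : List ℕ → List ℕ → Bool
orderIso s q =
  all (λ { (x₁ , x₂) → all (λ { (y₁ , y₂) → eqB (x₁ <ᵇ y₁) (x₂ <ᵇ y₂) }) z }) z
  where
  z = zip s q
  eqB : Bool → Bool → Bool
  eqB true  b = b
  eqB false b = not b

contains : List ℕ → List ℕ → Bool
contains p q = any (λ s → orderIso s q) (subseqs (length q) p)

avoids : List ℕ → List ℕ → Bool
avoids p q = not (contains p q)

S : ℕ → List ℕ → ℕ
S n q = length (filter (λ p → T? (avoids p q)) (perms n))

q12453 : List ℕ
q12453 = 1 ∷ 2 ∷ 4 ∷ 5 ∷ 3 ∷ []

-- "L(q) ≥ x" and "L(q) ≤ x" for a decimal x = c/100, where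
-- L(q) = lim_{n→∞} S_n(q)^{1/n} (the limit exists).  Since the limit exists,
-- L(q) ≥ c/100 iff for every rational a/b < c/100, eventually S_n(q) ≥ (a/b)^n;
-- L(q) ≤ c/100 iff for every rational a/b > c/100, eventually S_n(q) ≤ (a/b)^n.
L≥centi : List ℕ → ℕ → Set
L≥centi q c = ∀ (a b : ℕ) → 0 < b → a * 100 < c * b →
  Σ' ℕ (λ N → ∀ n → N ≤ n → a ^ n ≤ S n q * b ^ n)
  where
  open import Data.Product using () renaming (Σ to Σ')

L≤centi : List ℕ → ℕ → Set
L≤centi q c = ∀ (a b : ℕ) → 0 < b → c * b < a * 100 →
  Σ' ℕ (λ N → ∀ n → N ≤ n → S n q * b ^ n ≤ a ^ n)
  where
  open import Data.Product using () renaming (Σ to Σ')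

{-# OPTIONS --safe #-}

-- Build a permutation by inserting new minima. Inserting one into a word avoiding 1 ⊕ q creates no
-- copy of 1 ⊕ q exactly when the letters to the right of it avoid q; here 1342 = 1 ⊕ 231 and
-- 12453 = 1 ⊕ 1342.
--
-- For 1342, all that matters of a word is the list of lengths of the descending runs of its longest
-- suffix avoiding 231. At x = 1/8 the resulting generating tree has a product-form solution: giving
-- a run of length r the weight Q r, where ∑ Q r yʳ = ½ (1 + 8y + (1 - 4y)^{3/2} (1 - y)^{-1/2}), the
-- weights of the children of a node add up to at most 8 times its own. So S_n(1342) ≤ 8ⁿ.
--
-- Upper bound: removing the left-to-right minima from a permutation avoiding 12453 leaves one
-- avoiding 1342, and the permutation is recovered from the positions and the values removed. So
-- S_n ≤ ∑_k C(n,k)² 8ⁿ⁻ᵏ ≤ (1 + √8)²ⁿ, and √8 < 99/35 gives (134/35)² < 14.66.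
--
-- Lower bound: a skew sum of blocks avoiding 1342, of m letters each, still avoids 12453 after d
-- minima per block are interleaved with it, freely in value with one block and in position with the
-- previous one. So L(12453)ᵈ⁺ᵐ ≥ C(m+d,d) C(m+d-1,d) S_m(1342). That S_m(1342) ≥ (39/5)ᵐ for some
-- m ≥ 1 follows from the functional equations of the generating tree at x = 5/39: starting from 1,
-- their iterates grow faster than the lengths of the walks they account for.

module Submission where

-- The two bounds use the tree in opposite directions. For the upper bound `gen` must reach every
-- avoider of 1342; for the lower bound `Stage` must only stay inside the avoiders of 12453. Each
-- direction gives one inequality with `Z`.
--
-- The constants at x = 1/8 come from the equations for the weights P r, Q r of the walks that
-- eliminate a run r just created, just uncovered: Q r = 1 + x ∑ P (2 + c) Q b over c + b = r - 1,
-- and P r = (1 + x P 1) Q r. With Q 1 = 5/4 they give P 1 = 40/27 and x (1 + x P 1) = 4/27, whence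
-- the factor 27/4.
--
-- S_m(1342) is of order m^(-5/2) 8ᵐ, so it passes (39/5)ᵐ only at several hundred letters, too late
-- for evaluating `Z` from its definition. The iteration works because the equations are quadratic:
-- iterates that have become large about square at every step, while the walk lengths only double.
-- The margin of (1 + √7.8)² ≈ 14.386 over 14.12 pays for the polynomial factor lost in the two
-- binomials at d = 89, m = 251.

open import Defs
open import Data.Nat as ℕ using (ℕ; zero; suc)
open import Data.List using (List; []; _∷_)
open import Data.Product using (_×_; _,_; proj₁; proj₂; ∃; ∃₂)
open import Data.Empty using (⊥; ⊥-elim)
open import Function using (_∘_)
open import Relation.Nullary using (¬_; Dec; yes; no)
open import Relation.Binary.PropositionalEquality hiding ([_])

-- The generating tree of 1342

-- A stack lists, from left to right, the lengths of the descending runs of the longest suffix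
-- avoiding 231 of a word avoiding 1342. A new minimum goes in front of that suffix (a new run of
-- length 1), or behind the c-th letter of a run of length r, c ≥ 1: then the runs before are lost,
-- and that run becomes two, of lengths c + 1 and r - c. Z n s is the number of ways to make n such
-- insertions. Runs of length 0 may occur and are harmless.
splitSum : (List ℕ → ℕ) → ℕ → ℕ → List ℕ → ℕ
splitSum f c zero    s = 0
splitSum f c (suc b) s = f (2 ℕ.+ c ∷ b ∷ s) ℕ.+ splitSum f (suc c) b s

popSum : (List ℕ → ℕ) → List ℕ → ℕ
popSum f []      = 0
popSum f (r ∷ s) = splitSum f 0 r s ℕ.+ popSum f s

Z : ℕ → List ℕ → ℕ
Z zero    s = 1
Z (suc n) s = Z n (1 ∷ s) ℕ.+ popSum (Z n) s

-- The upper bound 8ⁿ for `Z n []`.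

module EightBound where
  import Data.Nat.Properties as ℕₚ
  import Data.Integer as ℤ
  open import Data.Rational using (ℚ; 0ℚ; 1ℚ; ½; _+_; _*_; _-_; -_; 1/_; _/_; _≤_; _<_; >-nonZero; positive; nonNegative)
  open import Data.Rational.Properties
  open import Data.Rational.Solver
  open import Relation.Nullary.Decidable using (from-yes)
  open +-*-Solver using (solve; _:=_; _:+_; _:*_; _:-_; con)

  -- By recursion, so that `ι (suc n)` reduces to `1ℚ + ι n`, the form handed to the ring solver.
  ι : ℕ → ℚ
  ι zero    = 0ℚ
  ι (suc n) = 1ℚ + ι n

  ι-+ : ∀ m n → ι (m ℕ.+ n) ≡ ι m + ι n
  ι-+ zero    n = sym (+-identityˡ (ι n))
  ι-+ (suc m) n = trans (cong (1ℚ +_) (ι-+ m n)) (sym (+-assoc 1ℚ (ι m) (ι n)))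

  ι-* : ∀ m n → ι (m ℕ.* n) ≡ ι m * ι n
  ι-* zero    n = sym (*-zeroˡ (ι n))
  ι-* (suc m) n = trans (ι-+ n (m ℕ.* n)) (trans (cong (ι n +_) (ι-* m n))
    (solve 2 (λ x y → y :+ x :* y := (con 1ℚ :+ x) :* y) refl (ι m) (ι n)))

  0≤ι : ∀ n → 0ℚ ≤ ι n
  0≤ι zero    = ≤-refl
  0≤ι (suc n) = +-mono-≤ (from-yes (0ℚ ≤? 1ℚ)) (0≤ι n)

  0<ι-suc : ∀ n → 0ℚ < ι (suc n)
  0<ι-suc n = +-mono-<-≤ (from-yes (0ℚ <? 1ℚ)) (0≤ι n)

  ι-mono-< : ∀ {m n} → m ℕ.< n → ι m < ι n
  ι-mono-< {zero}  {suc n} _          = 0<ι-suc n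
  ι-mono-< {suc m} {suc n} (ℕ.s≤s lt) = +-monoʳ-< 1ℚ (ι-mono-< lt)

  ι-cancel-≤ : ∀ {m n} → ι m ≤ ι n → m ℕ.≤ n
  ι-cancel-≤ {m} {n} le with m ℕₚ.≤? n
  ... | yes p = p
  ... | no ¬p = ⊥-elim (<-irrefl refl (<-≤-trans (ι-mono-< (ℕₚ.≰⇒> ¬p)) le))

  -- Abstract because unfolding recip makes conversion checks on closed rationals infeasible.
  abstract
    recip : ℕ → ℚ
    recip k = (1/ ι (suc k)) {{>-nonZero (0<ι-suc k)}}

    ι-recip : ∀ k → ι (suc k) * recip k ≡ 1ℚ
    ι-recip k = *-inverseʳ (ι (suc k)) {{>-nonZero (0<ι-suc k)}}

    0≤recip : ∀ k → 0ℚ ≤ recip k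
    0≤recip k = <⇒≤ (positive⁻¹ _ {{1/pos⇒pos (ι (suc k)) {{positive (0<ι-suc k)}}}})

  ι-cancel : ∀ k {x y} → ι (suc k) * x ≡ ι (suc k) * y → x ≡ y
  ι-cancel k {x} {y} eq = trans (sym (undo x)) (trans (cong (recip k *_) eq) (undo y))
    where
    undo : ∀ z → recip k * (ι (suc k) * z) ≡ z
    undo z = trans (solve 3 (λ r i z → r :* (i :* z) := (i :* r) :* z) refl (recip k) (ι (suc k)) z)
                   (trans (cong (_* z) (ι-recip k)) (*-identityˡ z))

  conv : (ℕ → ℚ) → (ℕ → ℚ) → ℕ → ℚ
  conv f g zero    = f 0 * g 0
  conv f g (suc n) = f 0 * g (suc n) + conv (f ∘ suc) g n

  conv-last : ∀ f g n → conv f g (suc n) ≡ conv f (g ∘ suc) n + f (suc n) * g 0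
  conv-last f g zero    = refl
  conv-last f g (suc n) = trans (cong (f 0 * g (suc (suc n)) +_) (conv-last (f ∘ suc) g n))
    (sym (+-assoc (f 0 * g (suc (suc n))) (conv (f ∘ suc) (g ∘ suc) n) (f (suc (suc n)) * g 0)))

  conv-comm : ∀ f g n → conv f g n ≡ conv g f n
  conv-comm f g zero    = *-comm (f 0) (g 0)
  conv-comm f g (suc n) = trans (cong₂ _+_ (*-comm (f 0) (g (suc n))) (conv-comm (f ∘ suc) g n))
    (trans (+-comm (g (suc n) * f 0) (conv g (f ∘ suc) n)) (sym (conv-last g f n)))

  conv-congˡ : ∀ {f f′} → (∀ i → f i ≡ f′ i) → ∀ g n → conv f g n ≡ conv f′ g n
  conv-congˡ eq g zero    = cong (_* g 0) (eq 0)
  conv-congˡ eq g (suc n) = cong₂ _+_ (cong (_* g (suc n)) (eq 0)) (conv-congˡ (eq ∘ suc) g n)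

  conv-+ˡ : ∀ f f′ g n → conv (λ i → f i + f′ i) g n ≡ conv f g n + conv f′ g n
  conv-+ˡ f f′ g zero    = *-distribʳ-+ (g 0) (f 0) (f′ 0)
  conv-+ˡ f f′ g (suc n) = trans (cong ((f 0 + f′ 0) * g (suc n) +_) (conv-+ˡ (f ∘ suc) (f′ ∘ suc) g n))
    (solve 5 (λ x y z u v → (x :+ y) :* z :+ (u :+ v) := x :* z :+ u :+ (y :* z :+ v)) refl
      (f 0) (f′ 0) (g (suc n)) (conv (f ∘ suc) g n) (conv (f′ ∘ suc) g n))

  conv-*ˡ : ∀ c f g n → conv (λ i → c * f i) g n ≡ c * conv f g n
  conv-*ˡ c f g zero    = *-assoc c (f 0) (g 0)
  conv-*ˡ c f g (suc n) = trans (cong (c * f 0 * g (suc n) +_) (conv-*ˡ c (f ∘ suc) g n))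
    (solve 4 (λ c x z u → c :* x :* z :+ c :* u := c :* (x :* z :+ u)) refl
      c (f 0) (g (suc n)) (conv (f ∘ suc) g n))

  -- The operator y d/dy on coefficient sequences.
  θ : (ℕ → ℚ) → ℕ → ℚ
  θ f i = ι i * f i

  conv-θ-suc : ∀ f g n → conv (θ f ∘ suc) g n ≡ conv (f ∘ suc) g n + conv (θ (f ∘ suc)) g n
  conv-θ-suc f g n = trans
    (conv-congˡ (λ i → solve 2 (λ i x → (con 1ℚ :+ i) :* x := x :+ i :* x) refl (ι i) (f (suc i))) g n)
    (conv-+ˡ (f ∘ suc) (θ (f ∘ suc)) g n)

  leibniz : ∀ f g n → conv (θ f) g n + conv f (θ g) n ≡ ι n * conv f g n
  leibniz f g zero    = solve 2 (λ x y → con 0ℚ :* x :* y :+ x :* (con 0ℚ :* y) := con 0ℚ :* (x :* y)) refl (f 0) (g 0)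
  leibniz f g (suc n) = trans
    (cong (λ z → 0ℚ * f 0 * g (suc n) + z + conv f (θ g) (suc n)) (conv-θ-suc f g n))
    (trans
      (solve 6 (λ x y n c d e →
          con 0ℚ :* x :* y :+ (c :+ d) :+ (x :* ((con 1ℚ :+ n) :* y) :+ e)
          := (con 1ℚ :+ n) :* (x :* y) :+ c :+ (d :+ e)) refl
        (f 0) (g (suc n)) (ι n) (conv (f ∘ suc) g n) (conv (θ (f ∘ suc)) g n) (conv (f ∘ suc) (θ g) n))
      (trans (cong (ι (suc n) * (f 0 * g (suc n)) + conv (f ∘ suc) g n +_) (leibniz (f ∘ suc) g n))
        (solve 3 (λ n p c → (con 1ℚ :+ n) :* p :+ c :+ n :* c := (con 1ℚ :+ n) :* (p :+ c)) refl
          (ι n) (f 0 * g (suc n)) (conv (f ∘ suc) g n))))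

  -- Coefficients of E(y) = (1 - 4y)^{3/2} (1 - y)^{-1/2}, from 2 (1 - y) (1 - 4y) E′ = (8y - 11) E.
  E : ℕ → ℚ
  E zero          = 1ℚ
  E (suc zero)    = - (ι 11 * ½)
  E (suc (suc k)) = ((ι 10 * ι (suc k) - ι 11) * E (suc k) - ι 8 * (ι k - 1ℚ) * E k) * (½ * recip (suc k))

  E-rec : ∀ k → ι 2 * θ E (suc (suc k)) ≡
    ι 10 * θ E (suc k) + (- ι 11 * E (suc k) + (- ι 8 * θ E k + ι 8 * E k))
  E-rec k = trans
    (solve 3 (λ i r x → con (ι 2) :* (i :* (x :* (con ½ :* r))) := (i :* r) :* x) refl
       (ι (suc (suc k))) (recip (suc k)) ((ι 10 * ι (suc k) - ι 11) * E (suc k) - ι 8 * (ι k - 1ℚ) * E k))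
    (trans (cong (_* ((ι 10 * ι (suc k) - ι 11) * E (suc k) - ι 8 * (ι k - 1ℚ) * E k)) (ι-recip (suc k)))
     (solve 3 (λ i x y →
        con 1ℚ :* ((con (ι 10) :* (con 1ℚ :+ i) :- con (ι 11)) :* x :- con (ι 8) :* (i :- con 1ℚ) :* y)
        := con (ι 10) :* ((con 1ℚ :+ i) :* x) :+ (con (- ι 11) :* x :+ (con (- ι 8) :* (i :* y) :+ con (ι 8) :* y)))
        refl (ι k) (E (suc k)) (E k)))

  27/4 5/4 27/8 81/16 : ℚ
  27/4 = ℤ.+ 27 / 4
  5/4  = ℤ.+ 5 / 4
  27/8  = ℤ.+ 27 / 8
  81/16 = ℤ.+ 81 / 16

  E₂ : E 2 ≡ 27/8
  E₂ = ι-cancel 1 (ι-cancel 1 (E-rec 0))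

  E₃ : E 3 ≡ 81/16
  E₃ = ι-cancel 1 (ι-cancel 2 (trans (solve 1 (λ x → con (ι 3) :* (con (ι 2) :* x) := con (ι 2) :* (con (ι 3) :* x)) refl (E 3))
    (trans (E-rec 1) (cong (λ x → ι 10 * (ι 2 * x) + (- ι 11 * x + (- ι 8 * θ E 1 + ι 8 * E 1))) E₂))))

  E² : ℕ → ℚ
  E² = conv E E

  θE·E : ∀ n → ι 2 * conv (θ E) E n ≡ ι n * E² n
  θE·E n = trans (solve 1 (λ x → con (ι 2) :* x := x :+ x) refl (conv (θ E) E n))
    (trans (cong (conv (θ E) E n +_) (conv-comm (θ E) E n)) (leibniz E E n))

  -- Multiplying the differential equation of `E` by `E` gives (1 - y) (1 - 4y) (E²)′ = (8y - 11)
  -- E², because 2 E E′ = (E²)′.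
  E²-rec : ∀ n → ι (suc (suc n)) * E² (suc (suc n)) ≡
    (ι 5 * ι (suc n) - ι 11) * E² (suc n) - ι 4 * (ι n - ι 2) * E² n
  E²-rec n = begin
    ι (suc (suc n)) * E² (suc (suc n))
      ≡⟨ sym (θE·E (suc (suc n))) ⟩
    ι 2 * (0ℚ * 1ℚ * E (suc (suc n)) + (1ℚ * E 1 * E (suc n) + u))
      ≡⟨ solve 3 (λ x y u → con (ι 2) :* (con 0ℚ :* con 1ℚ :* x :+ (con 1ℚ :* con (E 1) :* y :+ u))
                   := con (- ι 11) :* y :+ con (ι 2) :* u) refl (E (suc (suc n))) (E (suc n)) u ⟩
    - ι 11 * E (suc n) + ι 2 * u
      ≡⟨ cong (- ι 11 * E (suc n) +_) 2u ⟩
    - ι 11 * E (suc n) + (ι 10 * t′ + (- ι 11 * a′ + (- ι 8 * t + ι 8 * a)))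
      ≡⟨ solve 5 (λ e t′ a′ t a →
           con (- ι 11) :* e :+ (con (ι 10) :* t′ :+ (con (- ι 11) :* a′ :+ (con (- ι 8) :* t :+ con (ι 8) :* a)))
           := con (ι 5) :* (con (ι 2) :* (con 0ℚ :* con 1ℚ :* e :+ t′)) :- con (ι 11) :* (con 1ℚ :* e :+ a′)
              :- con (ι 4) :* (con (ι 2) :* t) :+ con (ι 8) :* a) refl (E (suc n)) t′ a′ t a ⟩
    ι 5 * (ι 2 * conv (θ E) E (suc n)) - ι 11 * E² (suc n) - ι 4 * (ι 2 * t) + ι 8 * a
      ≡⟨ cong₂ (λ x y → ι 5 * x - ι 11 * E² (suc n) - ι 4 * y + ι 8 * a) (θE·E (suc n)) (θE·E n) ⟩
    ι 5 * (ι (suc n) * E² (suc n)) - ι 11 * E² (suc n) - ι 4 * (ι n * a) + ι 8 * a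
      ≡⟨ solve 4 (λ i j x y →
           con (ι 5) :* (i :* x) :- con (ι 11) :* x :- con (ι 4) :* (j :* y) :+ con (ι 8) :* y
           := (con (ι 5) :* i :- con (ι 11)) :* x :- con (ι 4) :* (j :- con (ι 2)) :* y)
           refl (ι (suc n)) (ι n) (E² (suc n)) a ⟩
    (ι 5 * ι (suc n) - ι 11) * E² (suc n) - ι 4 * (ι n - ι 2) * E² n ∎
    where
    open ≡-Reasoning
    u  = conv (θ E ∘ suc ∘ suc) E n
    t′ = conv (θ E ∘ suc) E n
    a′ = conv (E ∘ suc) E n
    t  = conv (θ E) E n
    a  = E² n
    2u : ι 2 * u ≡ ι 10 * t′ + (- ι 11 * a′ + (- ι 8 * t + ι 8 * a))
    2u = trans (sym (conv-*ˡ (ι 2) (θ E ∘ suc ∘ suc) E n))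
      (trans (conv-congˡ E-rec E n)
      (trans (conv-+ˡ _ _ E n)
      (cong₂ _+_ (conv-*ˡ (ι 10) (θ E ∘ suc) E n)
      (trans (conv-+ˡ _ _ E n)
      (cong₂ _+_ (conv-*ˡ (- ι 11) (E ∘ suc) E n)
      (trans (conv-+ˡ _ _ E n)
      (cong₂ _+_ (conv-*ˡ (- ι 8) (θ E) E n) (conv-*ˡ (ι 8) E E n))))))))

  -- E² = (1 - 4y)³ / (1 - y) = 1 - 11y + 37y² - 27 (y³ + y⁴ + ⋯).
  E²-tail : ∀ n → E² (3 ℕ.+ n) ≡ - ι 27 × E² (4 ℕ.+ n) ≡ - ι 27
  E²-tail zero    = E²₃ , ι-cancel 3 (trans (E²-rec 2)
    (cong₂ (λ x y → (ι 5 * ι 3 - ι 11) * x - ι 4 * (ι 2 - ι 2) * y) E²₃ E²₂))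
    where
    E²₂ : E² 2 ≡ ι 37
    E²₂ = ι-cancel 1 (E²-rec 0)
    E²₃ : E² 3 ≡ - ι 27
    E²₃ = ι-cancel 2 (trans (E²-rec 1) (cong (λ x → (ι 5 * ι 2 - ι 11) * x - ι 4 * (ι 1 - ι 2) * E² 1) E²₂))
  E²-tail (suc n) with E²-tail n
  ... | p , q = q , ι-cancel (4 ℕ.+ n) (trans (E²-rec (3 ℕ.+ n))
    (trans (cong₂ (λ x y → (ι 5 * ι (4 ℕ.+ n) - ι 11) * x - ι 4 * (ι (3 ℕ.+ n) - ι 2) * y) q p)
      (solve 1 (λ i → (con (ι 5) :* (con 1ℚ :+ i) :- con (ι 11)) :* con (- ι 27) :- con (ι 4) :* (i :- con (ι 2)) :* con (- ι 27)
                       := (con 1ℚ :+ (con 1ℚ :+ i)) :* con (- ι 27)) refl (ι (3 ℕ.+ n)))))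

  -- Coefficients of ½ (1 + 8y + E(y)).
  Q : ℕ → ℚ
  Q zero          = 1ℚ
  Q (suc zero)    = 5/4
  Q (suc (suc k)) = ½ * E (suc (suc k))

  -- In terms of F = ∑ Q r yʳ this is F² - (1 + 8y) F + 27y / (4 (1 - y)) = 0. Its discriminant (1 +
  -- 8y)² - 27y / (1 - y) equals (1 - 4y)³ / (1 - y), the square of E, and F is the root with F(0) =
  -- 1.
  Q-conv : ∀ n → conv (Q ∘ suc ∘ suc) Q n ≡ 27/4 * (Q (suc n) - 1ℚ)
  Q-conv zero          = cong (λ x → ½ * x * 1ℚ) E₂
  Q-conv (suc zero)    = trans (cong₂ (λ x y → ½ * x * 5/4 + ½ * y * 1ℚ) E₂ E₃)
                               (cong (λ x → 27/4 * (½ * x - 1ℚ)) (sym E₂))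
  -- `Q 0` and `Q 1` are split off because `Q` is half of `E` only from index 2 on. With its border
  -- terms restored, the rest becomes the coefficient 4 + m of `E²`, which is -27.
  Q-conv (suc (suc m)) = begin
    conv Q̂ Q (suc (suc m))
      ≡⟨ conv-last Q̂ Q (suc m) ⟩
    conv Q̂ (Q ∘ suc) (suc m) + Q (4 ℕ.+ m) * 1ℚ
      ≡⟨ cong (_+ Q (4 ℕ.+ m) * 1ℚ) (conv-last Q̂ (Q ∘ suc) m) ⟩
    conv Q̂ Q̂ m + Q (3 ℕ.+ m) * 5/4 + Q (4 ℕ.+ m) * 1ℚ
      ≡⟨ cong (λ z → z + Q (3 ℕ.+ m) * 5/4 + Q (4 ℕ.+ m) * 1ℚ)
           (trans (conv-*ˡ ½ Ê Q̂ m) (cong (½ *_) (trans (conv-comm Ê Q̂ m) (conv-*ˡ ½ Ê Ê m)))) ⟩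
    ½ * (½ * c) + ½ * x * 5/4 + ½ * y * 1ℚ
      ≡⟨ solve 3 (λ c x y → con ½ :* (con ½ :* c) :+ con ½ :* x :* con 5/4 :+ con ½ :* y :* con 1ℚ
           := con (½ * ½) :* (con 1ℚ :* y :+ (con (E 1) :* x :+ (c :+ x :* con (E 1) :+ y :* con 1ℚ)))
              :+ con (½ * 27/4) :* x) refl c x y ⟩
    ½ * ½ * (1ℚ * y + (E 1 * x + (c + x * E 1 + y * 1ℚ))) + ½ * 27/4 * x
      ≡⟨ cong (λ z → ½ * ½ * z + ½ * 27/4 * x) (trans (sym expand) (proj₂ (E²-tail m))) ⟩
    ½ * ½ * - ι 27 + ½ * 27/4 * x
      ≡⟨ solve 1 (λ x → con (½ * ½ * - ι 27) :+ con (½ * 27/4) :* x := con 27/4 :* (con ½ :* x :- con 1ℚ)) refl x ⟩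
    27/4 * (Q (suc (suc (suc m))) - 1ℚ) ∎
    where
    open ≡-Reasoning
    Q̂ = Q ∘ suc ∘ suc
    Ê = E ∘ suc ∘ suc
    c = conv Ê Ê m
    x = E (3 ℕ.+ m)
    y = E (4 ℕ.+ m)
    expand : E² (4 ℕ.+ m) ≡ 1ℚ * y + (E 1 * x + (c + x * E 1 + y * 1ℚ))
    expand = cong (λ z → 1ℚ * y + (E 1 * x + z))
      (trans (conv-last Ê E (suc m)) (cong (_+ y * 1ℚ) (conv-last Ê (E ∘ suc) m)))

  0≤+ : ∀ {p q} → 0ℚ ≤ p → 0ℚ ≤ q → 0ℚ ≤ p + q
  0≤+ = +-mono-≤

  0≤* : ∀ {p q} → 0ℚ ≤ p → 0ℚ ≤ q → 0ℚ ≤ p * q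
  0≤* {p} {q} 0≤p 0≤q =
    nonNegative⁻¹ (p * q) {{nonNeg*nonNeg⇒nonNeg p {{nonNegative 0≤p}} q {{nonNegative 0≤q}}}}

  *-monoˡ : ∀ {r p q} → 0ℚ ≤ r → p ≤ q → r * p ≤ r * q
  *-monoˡ {r} 0≤r = *-monoˡ-≤-nonNeg r {{nonNegative 0≤r}}

  0≤-⇒≤ : ∀ {p q} → 0ℚ ≤ q - p → p ≤ q
  0≤-⇒≤ {p} {q} le = subst₂ _≤_ (+-identityˡ p)
    (solve 2 (λ p q → q :- p :+ p := q) refl p q) (+-monoˡ-≤ p le)

  -- The recurrence writes each difference of consecutive coefficients as a nonnegative combination
  -- of the previous difference and the last coefficient, so growth propagates from 27/8 < 81/16.
  -- The bound 2 is what `1≤Q` asks of `E`.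
  E-increasing : ∀ j → ι 2 ≤ E (2 ℕ.+ j) × 0ℚ ≤ E (3 ℕ.+ j) - E (2 ℕ.+ j)
  E-increasing zero    = subst (ι 2 ≤_) (sym E₂) (from-yes (ι 2 ≤? 27/8)) ,
    subst (0ℚ ≤_) (sym (cong₂ _-_ E₃ E₂)) (from-yes (0ℚ ≤? (81/16 - 27/8)))
  E-increasing (suc j) with E-increasing j
  ... | lo , inc = 2≤y , subst (0ℚ ≤_) eq (0≤* 0≤r (0≤+ (0≤* (0≤+ (0≤* (0≤ι 8) (0≤ι j)) (0≤ι 8)) inc)
                                                      (0≤* (0≤ι 3) (≤-trans (0≤ι 2) 2≤y))))
    where
    x = E (2 ℕ.+ j)
    y = E (3 ℕ.+ j)
    r = ½ * recip (3 ℕ.+ j)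
    2≤y : ι 2 ≤ y
    2≤y = ≤-trans lo (0≤-⇒≤ inc)
    0≤r : 0ℚ ≤ r
    0≤r = 0≤* (from-yes (0ℚ ≤? ½)) (0≤recip (3 ℕ.+ j))
    eq : r * ((ι 8 * ι j + ι 8) * (y - x) + ι 3 * y) ≡ E (4 ℕ.+ j) - y
    eq = trans
      (solve 4 (λ r j x y → r :* ((con (ι 8) :* j :+ con (ι 8)) :* (y :- x) :+ con (ι 3) :* y) :=
        ((con (ι 10) :* (con 1ℚ :+ (con 1ℚ :+ (con 1ℚ :+ j))) :- con (ι 11)) :* y
          :- con (ι 8) :* (con 1ℚ :+ (con 1ℚ :+ j) :- con 1ℚ) :* x) :* r
        :- con (ι 2) :* ((con 1ℚ :+ (con 1ℚ :+ (con 1ℚ :+ (con 1ℚ :+ j)))) :* r) :* y) refl r (ι j) x y)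
      (cong (λ z → E (4 ℕ.+ j) - z) (trans (cong (_* y)
        (trans (solve 2 (λ i s → con (ι 2) :* (i :* (con ½ :* s)) := i :* s) refl (ι (4 ℕ.+ j)) (recip (3 ℕ.+ j)))
               (ι-recip (3 ℕ.+ j)))) (*-identityˡ y)))

  1≤Q : ∀ r → 1ℚ ≤ Q r
  1≤Q zero          = ≤-refl
  1≤Q (suc zero)    = from-yes (1ℚ ≤? 5/4)
  1≤Q (suc (suc j)) = *-monoˡ {½} (from-yes (0ℚ ≤? ½)) (proj₁ (E-increasing j))

  0≤Q : ∀ r → 0ℚ ≤ Q r
  0≤Q r = ≤-trans (0≤ι 1) (1≤Q r)

  -- The sum of ω over the stacks counted by popSum is 27/4 (ω s - 1), and 27/4 + Q 1 = 8.
  ω : List ℕ → ℚ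
  ω []      = 1ℚ
  ω (r ∷ s) = Q r * ω s

  1≤ω : ∀ s → 1ℚ ≤ ω s
  1≤ω []      = ≤-refl
  1≤ω (r ∷ s) = ≤-trans (1≤Q r) (subst (_≤ Q r * ω s) (*-identityʳ (Q r)) (*-monoˡ (0≤Q r) (1≤ω s)))

  module _ (κ : ℚ) {f : List ℕ → ℕ} (f≤ : ∀ s → ι (f s) ≤ κ * ω s) where

    -- The two runs left by a split have lengths 2 + c + i and b - i, so their product weights add
    -- up to a convolution.
    splitSum≤ : ∀ c b s → ι (splitSum f c (suc b) s) ≤ κ * (conv (λ i → Q (2 ℕ.+ c ℕ.+ i)) Q b * ω s)
    splitSum≤ c b s = subst (_≤ _) (sym (ι-+ (f (2 ℕ.+ c ∷ b ∷ s)) (splitSum f (suc c) b s)))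
      (≤-trans (+-mono-≤ (f≤ (2 ℕ.+ c ∷ b ∷ s)) (rest b)) (≤-reflexive (shape b)))
      where
      q = λ i → Q (2 ℕ.+ c ℕ.+ i)
      later : ℕ → ℚ
      later zero    = 0ℚ
      later (suc b) = conv (q ∘ suc) Q b
      rest : ∀ b → ι (splitSum f (suc c) b s) ≤ κ * (later b * ω s)
      rest zero    = ≤-reflexive (solve 2 (λ k w → con 0ℚ := k :* (con 0ℚ :* w)) refl κ (ω s))
      rest (suc b) = ≤-trans (splitSum≤ (suc c) b s) (≤-reflexive (cong (λ z → κ * (z * ω s))
        (conv-congˡ (λ i → cong (λ j → Q (2 ℕ.+ j)) (sym (ℕₚ.+-suc c i))) Q b)))
      shape : ∀ b → κ * (Q (2 ℕ.+ c) * (Q b * ω s)) + κ * (later b * ω s) ≡ κ * (conv q Q b * ω s)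
      shape b with cong (λ j → Q (2 ℕ.+ j)) (ℕₚ.+-identityʳ c)
      shape zero | eq = trans
        (solve 4 (λ k x y w → k :* (x :* (y :* w)) :+ k :* (con 0ℚ :* w) := k :* (x :* y :* w)) refl κ (Q (2 ℕ.+ c)) (Q 0) (ω s))
        (cong (λ z → κ * (z * Q 0 * ω s)) (sym eq))
      shape (suc b) | eq = trans
        (solve 5 (λ k x y w l → k :* (x :* (y :* w)) :+ k :* (l :* w) := k :* ((x :* y :+ l) :* w)) refl κ (Q (2 ℕ.+ c)) (Q (suc b)) (ω s) (later (suc b)))
        (cong (λ z → κ * ((z * Q (suc b) + later (suc b)) * ω s)) (sym eq))

    popSum≤ : ∀ s → ι (popSum f s) ≤ κ * (27/4 * (ω s - 1ℚ))
    popSum≤ []            = ≤-reflexive (solve 1 (λ k → con 0ℚ := k :* (con 27/4 :* (con 1ℚ :- con 1ℚ))) refl κ)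
    popSum≤ (zero ∷ s)    = ≤-trans (popSum≤ s) (≤-reflexive (cong (λ z → κ * (27/4 * (z - 1ℚ))) (sym (*-identityˡ (ω s)))))
    popSum≤ (suc b ∷ s)   = subst (_≤ _) (sym (ι-+ (splitSum f 0 (suc b) s) (popSum f s)))
      (≤-trans (+-mono-≤ (splitSum≤ 0 b s) (popSum≤ s)) (≤-reflexive
        (trans (cong (λ z → κ * (z * ω s) + κ * (27/4 * (ω s - 1ℚ))) (Q-conv b))
          (solve 3 (λ k q w → k :* (con 27/4 :* (q :- con 1ℚ) :* w) :+ k :* (con 27/4 :* (w :- con 1ℚ))
                      := k :* (con 27/4 :* (q :* w :- con 1ℚ))) refl κ (Q (suc b)) (ω s)))))

  Z≤ω : ∀ n s → ι (Z n s) ≤ ι (8 ℕ.^ n) * ω s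
  Z≤ω zero    s = ≤-trans (1≤ω s) (≤-reflexive (sym (*-identityˡ (ω s))))
  Z≤ω (suc n) s = subst (_≤ ι (8 ℕ.^ suc n) * ω s) (sym (ι-+ (Z n (1 ∷ s)) (popSum (Z n) s)))
    (≤-trans (+-mono-≤ (Z≤ω n (1 ∷ s)) (popSum≤ κ (Z≤ω n) s)) (0≤-⇒≤ {q = ι (8 ℕ.^ suc n) * ω s} (subst (0ℚ ≤_) eq
      (0≤* (0≤ι (8 ℕ.^ n)) (from-yes (0ℚ ≤? 27/4))))))
    where
    κ = ι (8 ℕ.^ n)
    -- The children weigh 8 ω s - 27/4 together; the slack 27/4 is the constant term of `popSum≤`.
    eq : κ * 27/4 ≡ ι (8 ℕ.^ suc n) * ω s - (κ * (5/4 * ω s) + κ * (27/4 * (ω s - 1ℚ)))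
    eq = trans
      (solve 2 (λ k w → k :* con 27/4 := con (ι 8) :* k :* w :- (k :* (con 5/4 :* w) :+ k :* (con 27/4 :* (w :- con 1ℚ))))
         refl κ (ω s))
      (cong (λ z → z * ω s - (κ * (5/4 * ω s) + κ * (27/4 * (ω s - 1ℚ)))) (sym (ι-* 8 (8 ℕ.^ n))))

  Z≤8^ : ∀ n → Z n [] ℕ.≤ 8 ℕ.^ n
  Z≤8^ n = ι-cancel-≤ (≤-trans (Z≤ω n []) (≤-reflexive (*-identityʳ (ι (8 ℕ.^ n)))))

open EightBound using (Z≤8^)

open import Data.Nat
open import Data.Nat.Properties
open import Data.Nat.DivMod using (_/_; _%_; m/n*n≤m; m≡m%n+[m/n]*n; m%n<n; /-monoˡ-≤; m*n/n≡m)
open import Data.Nat.Tactic.RingSolver using (solve-∀)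
open import Data.Bool using (Bool; true; false; if_then_else_; T; not)
open import Data.Bool.ListAction using (all)
open import Data.Bool.Properties using (T?; T-∧)
open import Data.List using ([_]; _++_; length; map; concat; concatMap; filter; upTo; zip; applyUpTo; replicate)
open import Data.List.Properties using (++-assoc; ++-identityʳ; ∷-injective; ∷-injectiveʳ; length-++; length-map; concat-++; filter-++; filter-all; filter-accept; filter-reject)
open import Data.List.Membership.Propositional using (_∈_; _∉_; find; lose)
open import Data.List.Membership.Propositional.Properties
open import Data.List.Membership.DecPropositional _≟_ using (_∈?_)
open import Data.List.Relation.Unary.Any as Any using (Any; here; there)
open import Data.List.Relation.Unary.Any.Properties using (any⁺; any⁻)
open import Data.List.Relation.Unary.All as All using (All; []; _∷_)
open import Data.List.Relation.Unary.All.Properties using (all⁺; ¬Any⇒All¬; All¬⇒¬Any)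
import Data.List.Relation.Unary.All.Properties as All
open import Data.List.Relation.Unary.AllPairs using (AllPairs; []; _∷_)
open import Data.List.Relation.Unary.Unique.Propositional using (Unique)
open import Data.List.Relation.Unary.Unique.Propositional.Properties as Unique using (Unique[x∷xs]⇒x∉xs)
open import Data.List.Relation.Binary.Pointwise using (Pointwise-≡⇒≡)
open import Data.List.Relation.Binary.Sublist.Propositional using (_⊆_; []; _∷_; _∷ʳ_; ⊆-refl; ⊆-trans; ⊆-reflexive; minimum; from∈; to∈)
open import Data.List.Relation.Binary.Sublist.Propositional.Properties using (++⁺; ++⁺ˡ; ++⁺ʳ; ∷ˡ⁻; to-≋; Any-resp-⊆)
open import Data.Sum using (_⊎_; inj₁; inj₂)
open import Data.Unit using (⊤; tt)
open import Function using (Equivalence)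

-- Exponential growth of Z

splitSum-linear : ∀ a b f g c d s →
  splitSum (λ t → a * f t + b * g t) c d s ≡ a * splitSum f c d s + b * splitSum g c d s
splitSum-linear a b f g c zero    s = sym (cong₂ _+_ (*-zeroʳ a) (*-zeroʳ b))
splitSum-linear a b f g c (suc d) s =
  trans (cong (a * f (2 + c ∷ d ∷ s) + b * g (2 + c ∷ d ∷ s) +_) (splitSum-linear a b f g (suc c) d s))
        (lemma a b (f (2 + c ∷ d ∷ s)) (g (2 + c ∷ d ∷ s)) (splitSum f (suc c) d s) (splitSum g (suc c) d s))
  where
  lemma : ∀ a b x y u v → a * x + b * y + (a * u + b * v) ≡ a * (x + u) + b * (y + v)
  lemma = solve-∀

popSum-linear : ∀ a b f g s →
  popSum (λ t → a * f t + b * g t) s ≡ a * popSum f s + b * popSum g s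
popSum-linear a b f g []      = sym (cong₂ _+_ (*-zeroʳ a) (*-zeroʳ b))
popSum-linear a b f g (r ∷ s) =
  trans (cong₂ _+_ (splitSum-linear a b f g 0 r s) (popSum-linear a b f g s))
        (lemma a b (splitSum f 0 r s) (splitSum g 0 r s) (popSum f s) (popSum g s))
  where
  lemma : ∀ a b x y u v → a * x + b * y + (a * u + b * v) ≡ a * (x + u) + b * (y + v)
  lemma = solve-∀

splitSum-mono : ∀ {f g} → (∀ s → f s ≤ g s) → ∀ c b s → splitSum f c b s ≤ splitSum g c b s
splitSum-mono le c zero    s = z≤n
splitSum-mono le c (suc b) s = +-mono-≤ (le _) (splitSum-mono le (suc c) b s)

popSum-mono : ∀ {f g} → (∀ s → f s ≤ g s) → ∀ s → popSum f s ≤ popSum g s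
popSum-mono le []      = z≤n
popSum-mono le (r ∷ s) = +-mono-≤ (splitSum-mono le 0 r s) (popSum-mono le s)

-- The default 0 makes a cut-off list of weights a valid lower bound for all run lengths.
get : List ℕ → ℕ → ℕ
get []       i       = 0
get (x ∷ xs) zero    = x
get (x ∷ xs) (suc i) = get xs i

get-applyUpTo : ∀ f n i → get (applyUpTo f n) i ≤ f i
get-applyUpTo f zero    i       = z≤n
get-applyUpTo f (suc n) zero    = ≤-refl
get-applyUpTo f (suc n) (suc i) = get-applyUpTo (f ∘ suc) n i

get-replicate : ∀ n x i → get (replicate n x) i ≤ x
get-replicate zero    x i       = z≤n
get-replicate (suc n) x zero    = ≤-refl
get-replicate (suc n) x (suc i) = get-replicate n x i

splitConv : List ℕ → List ℕ → ℕ → ℕ → ℕ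
splitConv p q c zero    = 0
splitConv p q c (suc b) = get p (2 + c) * get q b + splitConv p q (suc c) b

module Kleene (u v D : ℕ) {{_ : NonZero u}} {{_ : NonZero D}} where

  -- A N s = ∑_{n ≤ N} Z n s vⁿ uᴺ⁻ⁿ: the generating function of n ↦ Z n s at v/u, truncated
  -- and cleared of denominators.
  A : ℕ → List ℕ → ℕ
  A zero    s = 1
  A (suc N) s = u * A N s + v ^ suc N * Z (suc N) s

  -- The functional equation of the tree: `u ^ suc N` stands for the empty walk, and every other
  -- walk begins with a step to a child.
  A-step : ∀ N s → A (suc N) s ≡ u ^ suc N + v * (A N (1 ∷ s) + popSum (A N) s)
  A-step zero    s = cong (λ x → u * 1 + x * (1 + popSum (λ _ → 1) s)) (*-identityʳ v)
  A-step (suc N) s = begin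
    u * A (suc N) s + v ^ (2 + N) * (Z (suc N) (1 ∷ s) + popSum (Z (suc N)) s)
      ≡⟨ cong (λ z → u * z + v ^ (2 + N) * (Z (suc N) (1 ∷ s) + popSum (Z (suc N)) s)) (A-step N s) ⟩
    u * (u ^ suc N + v * (A N (1 ∷ s) + popSum (A N) s)) + v * v ^ suc N * (Z (suc N) (1 ∷ s) + popSum (Z (suc N)) s)
      ≡⟨ lemma u v (u ^ suc N) (A N (1 ∷ s)) (popSum (A N) s) (v ^ suc N) (Z (suc N) (1 ∷ s)) (popSum (Z (suc N)) s) ⟩
    u * u ^ suc N + v * (A (suc N) (1 ∷ s) + (u * popSum (A N) s + v ^ suc N * popSum (Z (suc N)) s))
      ≡⟨ cong (λ z → u ^ (2 + N) + v * (A (suc N) (1 ∷ s) + z)) (sym (popSum-linear u (v ^ suc N) (A N) (Z (suc N)) s)) ⟩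
    u ^ (2 + N) + v * (A (suc N) (1 ∷ s) + popSum (A (suc N)) s) ∎
    where
    open ≡-Reasoning
    lemma : ∀ u v p a b e x y → u * (p + v * (a + b)) + v * e * (x + y) ≡ u * p + v * (u * a + e * x + (u * b + e * y))
    lemma = solve-∀

  -- The part of A N s contributed by walks that begin by uncovering the top run of s.
  Y : ℕ → List ℕ → ℕ
  Y zero    s = 1
  Y (suc N) s = u ^ suc N + v * popSum (A N) s

  Y-suc : ∀ N s → u * Y N s ≤ Y (suc N) s
  Y-suc zero    s = m≤m+n (u * 1) _
  Y-suc (suc N) s = begin
    u * (u ^ suc N + v * popSum (A N) s)          ≡⟨ lemma u v (u ^ suc N) (popSum (A N) s) ⟩
    u ^ (2 + N) + v * (u * popSum (A N) s)        ≤⟨ +-monoʳ-≤ (u ^ (2 + N)) (*-monoʳ-≤ v (≤-trans (m≤m+n _ _) (≤-reflexive (sym (popSum-linear u (v ^ suc N) (A N) (Z (suc N)) s))))) ⟩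
    u ^ (2 + N) + v * popSum (A (suc N)) s         ∎
    where
    open ≤-Reasoning
    lemma : ∀ u v p a → u * (p + v * a) ≡ u * p + v * (u * a)
    lemma = solve-∀

  Y-grow : ∀ K N s → u ^ K * Y N s ≤ Y (K + N) s
  Y-grow zero    N s = ≤-reflexive (+-identityʳ (Y N s))
  Y-grow (suc K) N s = ≤-trans (≤-reflexive (*-assoc u (u ^ K) (Y N s)))
    (≤-trans (*-monoʳ-≤ u (Y-grow K N s)) (Y-suc (K + N) s))

  -- Fixed-point iterates, rounded down to multiples of 1 / D and cut off at runs of length 13, for
  -- the weights P r, Q r (at v/u) of the walks that eliminate a run r just created, just uncovered.
  private instance
    u*D≢0 : NonZero (u * D)
    u*D≢0 = m*n≢0 u D

  -- Entries are D times the weights, so a product of two carries D²; together with the denominator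
  -- u of v/u this explains the divisor `u * D`.
  nextQ nextP : List ℕ → List ℕ → ℕ → ℕ
  nextQ p q r = (u * D * D + v * splitConv p q 0 r) / (u * D)
  nextP p q r = (nextQ p q r * (u * D) + v * (get p 1 * get q r)) / (u * D)

  step : List ℕ × List ℕ → List ℕ × List ℕ
  step (p , q) = applyUpTo (nextP p q) 14 , applyUpTo (nextQ p q) 14

  -- One insertion, after which each of the two runs on top may take x further insertions.
  double : ℕ → ℕ
  double x = suc (x + x)

  walkLength : ℕ → ℕ
  walkLength zero    = 0
  walkLength (suc k) = double (walkLength k)

  -- The start is weight 1: a run is given up at once, by a walk of length 0.
  weights : ℕ → List ℕ × List ℕ
  weights zero    = replicate 14 D , replicate 14 D
  weights (suc k) = step (weights k)

  -- After division by u ^ (K + N): walks of length at most K that eliminate the run r have weight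
  -- at least `get q r` / D, and may be followed by any walk counted in `Y N s`. Quantifying over
  -- the continuation is what lets two such bounds be chained.
  AcceptsQ AcceptsP : ℕ → List ℕ → Set
  AcceptsQ K q = ∀ N r s → get q r * (u ^ K * Y N s) ≤ D * Y (K + N) (r ∷ s)
  AcceptsP K p = ∀ N r s → get p r * (u ^ K * Y N s) ≤ D * A (K + N) (r ∷ s)

  module _ K p q (hp : AcceptsP K p) (hq : AcceptsQ K q) where

    private
      e = u ^ K

      u^double : ∀ K → u ^ double K ≡ u * (u ^ K * u ^ K)
      u^double K = cong (u *_) (^-distribˡ-+-* u K K)

      -- Eliminating the new run `r` uncovers `r′`, so a weight from `p` is followed by one from
      -- `q`, with `Y (K + N) (r′ ∷ s)` between them.
      two-steps : ∀ N r r′ s → get p r * get q r′ * (e * e * Y N s) ≤ D * D * A (K + (K + N)) (r ∷ r′ ∷ s)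
      two-steps N r r′ s = begin
        get p r * get q r′ * (e * e * Y N s)      ≡⟨ l₁ (get p r) (get q r′) e (Y N s) ⟩
        get p r * (e * (get q r′ * (e * Y N s)))  ≤⟨ *-monoʳ-≤ (get p r) (*-monoʳ-≤ e (hq N r′ s)) ⟩
        get p r * (e * (D * Y (K + N) (r′ ∷ s)))  ≡⟨ l₂ (get p r) e D (Y (K + N) (r′ ∷ s)) ⟩
        D * (get p r * (e * Y (K + N) (r′ ∷ s)))  ≤⟨ *-monoʳ-≤ D (hp (K + N) r (r′ ∷ s)) ⟩
        D * (D * A (K + (K + N)) (r ∷ r′ ∷ s))    ≡⟨ sym (*-assoc D D _) ⟩
        D * D * A (K + (K + N)) (r ∷ r′ ∷ s)      ∎
        where
        open ≤-Reasoning
        l₁ : ∀ p q e y → p * q * (e * e * y) ≡ p * (e * (q * (e * y)))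
        l₁ = solve-∀
        l₂ : ∀ p e d y → p * (e * (d * y)) ≡ d * (p * (e * y))
        l₂ = solve-∀

      splits : ∀ N s c b → splitConv p q c b * (e * e * Y N s) ≤ D * D * splitSum (A (K + (K + N))) c b s
      splits N s c zero    = z≤n
      splits N s c (suc b) = begin
        (get p (2 + c) * get q b + splitConv p q (suc c) b) * (e * e * Y N s)
          ≡⟨ *-distribʳ-+ (e * e * Y N s) (get p (2 + c) * get q b) _ ⟩
        get p (2 + c) * get q b * (e * e * Y N s) + splitConv p q (suc c) b * (e * e * Y N s)
          ≤⟨ +-mono-≤ (two-steps N (2 + c) b s) (splits N s (suc c) b) ⟩
        D * D * A (K + (K + N)) (2 + c ∷ b ∷ s) + D * D * splitSum (A (K + (K + N))) (suc c) b s
          ≡⟨ sym (*-distribˡ-+ (D * D) (A (K + (K + N)) (2 + c ∷ b ∷ s)) _) ⟩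
        D * D * splitSum (A (K + (K + N))) c (suc b) s ∎
        where open ≤-Reasoning

    nextQ-sound : ∀ N r s → nextQ p q r * (u * D) * (e * e * Y N s) ≤ D * D * Y (suc (K + (K + N))) (r ∷ s)
    nextQ-sound N r s = begin
      nextQ p q r * (u * D) * (e * e * Y N s)
        ≤⟨ *-monoˡ-≤ (e * e * Y N s) (m/n*n≤m (u * D * D + v * splitConv p q 0 r) (u * D)) ⟩
      (u * D * D + v * splitConv p q 0 r) * (e * e * Y N s)
        ≡⟨ l₁ u v D (splitConv p q 0 r) (e * e) (Y N s) ⟩
      D * D * (u * (e * e) * Y N s) + v * (splitConv p q 0 r * (e * e * Y N s))
        ≤⟨ +-mono-≤ (*-monoʳ-≤ (D * D) base) (*-monoʳ-≤ v (splits N s 0 r)) ⟩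
      D * D * (u ^ suc M + v * popSum (A M) s) + v * (D * D * splitSum (A M) 0 r s)
        ≡⟨ l₂ v (D * D) (u ^ suc M) (popSum (A M) s) (splitSum (A M) 0 r s) ⟩
      D * D * (u ^ suc M + v * (splitSum (A M) 0 r s + popSum (A M) s)) ∎
      where
      open ≤-Reasoning
      M = K + (K + N)
      base : u * (e * e) * Y N s ≤ Y (suc M) s
      base = subst₂ (λ x y → x * Y N s ≤ Y (suc y) s) (u^double K) (+-assoc K K N) (Y-grow (double K) N s)
      l₁ : ∀ u v d x e y → (u * d * d + v * x) * (e * y) ≡ d * d * (u * e * y) + v * (x * (e * y))
      l₁ = solve-∀
      l₂ : ∀ v d p a b → d * (p + v * a) + v * (d * b) ≡ d * (p + v * (b + a))
      l₂ = solve-∀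

    nextP-sound : ∀ N r s → nextP p q r * (u * D) * (e * e * Y N s) ≤ D * D * A (suc (K + (K + N))) (r ∷ s)
    nextP-sound N r s = begin
      nextP p q r * (u * D) * (e * e * Y N s)
        ≤⟨ *-monoˡ-≤ (e * e * Y N s) (m/n*n≤m (nextQ p q r * (u * D) + v * (get p 1 * get q r)) (u * D)) ⟩
      (nextQ p q r * (u * D) + v * (get p 1 * get q r)) * (e * e * Y N s)
        ≡⟨ l₁ v (nextQ p q r * (u * D)) (get p 1 * get q r) (e * e * Y N s) ⟩
      nextQ p q r * (u * D) * (e * e * Y N s) + v * (get p 1 * get q r * (e * e * Y N s))
        ≤⟨ +-mono-≤ (nextQ-sound N r s) (*-monoʳ-≤ v (two-steps N 1 r s)) ⟩
      D * D * (u ^ suc M + v * popSum (A M) (r ∷ s)) + v * (D * D * A M (1 ∷ r ∷ s))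
        ≡⟨ l₂ v (D * D) (u ^ suc M) (popSum (A M) (r ∷ s)) (A M (1 ∷ r ∷ s)) ⟩
      D * D * (u ^ suc M + v * (A M (1 ∷ r ∷ s) + popSum (A M) (r ∷ s)))
        ≡⟨ cong (D * D *_) (sym (A-step M (r ∷ s))) ⟩
      D * D * A (suc M) (r ∷ s) ∎
      where
      open ≤-Reasoning
      M = K + (K + N)
      l₁ : ∀ v x y z → (x + v * y) * z ≡ x * z + v * (y * z)
      l₁ = solve-∀
      l₂ : ∀ v d p a b → d * (p + v * a) + v * (d * b) ≡ d * (p + v * (b + a))
      l₂ = solve-∀

    private
      accept : ∀ {g g′ N} (F : ℕ → ℕ) → g ≤ g′ → ∀ y →
        g′ * (u * D) * (e * e * y) ≤ D * D * F (suc (K + (K + N))) →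
        g * (u ^ double K * y) ≤ D * F (double K + N)
      accept {g} {g′} {N} F g≤ y le = *-cancelˡ-≤ D (begin
        D * (g * (u ^ double K * y))   ≡⟨ cong (λ x → D * (g * (x * y))) (u^double K) ⟩
        D * (g * (u * (e * e) * y))    ≡⟨ l u D g (e * e) y ⟩
        g * (u * D) * (e * e * y)      ≤⟨ *-monoˡ-≤ (e * e * y) (*-monoˡ-≤ (u * D) g≤) ⟩
        g′ * (u * D) * (e * e * y)     ≤⟨ le ⟩
        D * D * F (suc (K + (K + N)))   ≡⟨ trans (*-assoc D D _) (cong (λ x → D * (D * F (suc x))) (sym (+-assoc K K N))) ⟩
        D * (D * F (double K + N))      ∎)
        where
        open ≤-Reasoning
        l : ∀ u d g e y → d * (g * (u * e * y)) ≡ g * (u * d) * (e * y)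
        l = solve-∀

    step-sound : AcceptsP (double K) (applyUpTo (nextP p q) 14) × AcceptsQ (double K) (applyUpTo (nextQ p q) 14)
    step-sound =
      (λ N r s → accept {N = N} (λ M → A M (r ∷ s)) (get-applyUpTo (nextP p q) 14 r) (Y N s) (nextP-sound N r s)) ,
      (λ N r s → accept {N = N} (λ M → Y M (r ∷ s)) (get-applyUpTo (nextQ p q) 14 r) (Y N s) (nextQ-sound N r s))

  Y≤Y∷ : ∀ N r s → Y N s ≤ Y N (r ∷ s)
  Y≤Y∷ zero    r s = ≤-refl
  Y≤Y∷ (suc N) r s = +-monoʳ-≤ (u ^ suc N) (*-monoʳ-≤ v (m≤n+m (popSum (A N) s) (splitSum (A N) 0 r s)))

  Y≤A : ∀ N s → Y N s ≤ A N s
  Y≤A zero    s = ≤-refl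
  Y≤A (suc N) s = subst (Y (suc N) s ≤_) (sym (A-step N s))
    (+-monoʳ-≤ (u ^ suc N) (*-monoʳ-≤ v (m≤n+m (popSum (A N) s) (A N (1 ∷ s)))))

  weights-sound : ∀ k → AcceptsP (walkLength k) (proj₁ (weights k)) × AcceptsQ (walkLength k) (proj₂ (weights k))
  weights-sound zero =
    (λ N r s → *-mono-≤ (get-replicate 14 D r) (≤-trans (start N r s) (Y≤A N (r ∷ s)))) ,
    (λ N r s → *-mono-≤ (get-replicate 14 D r) (start N r s))
    where
    start : ∀ N r s → 1 * Y N s ≤ Y N (r ∷ s)
    start N r s = ≤-trans (≤-reflexive (*-identityˡ (Y N s))) (Y≤Y∷ N r s)
  weights-sound (suc k) with weights k | weights-sound k
  ... | p , q | hp , hq = step-sound (walkLength k) p q hp hq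

  -- Divided by u ^ N, `A N s` is a sum of N + 1 terms `Z n s` (v/u)ⁿ, and one of them is at least
  -- their average.
  pigeonhole : ∀ c s N → c * suc N * u ^ N < A N s → ∃ λ n → c * u ^ n < v ^ n * Z n s
  pigeonhole c s zero    lt = 0 , subst (λ x → x * 1 < 1) (*-identityʳ c) lt
  pigeonhole c s (suc N) lt with <-≤-connex (c * u ^ suc N) (v ^ suc N * Z (suc N) s)
  ... | inj₁ big   = suc N , big
  ... | inj₂ small = pigeonhole c s N (*-cancelˡ-< u _ _ (+-cancelʳ-< (c * u ^ suc N) _ _ (begin-strict
      u * (c * suc N * u ^ N) + c * u ^ suc N      ≡⟨ l u c N (u ^ N) ⟩
      c * suc (suc N) * u ^ suc N                    <⟨ lt ⟩
      u * A N s + v ^ suc N * Z (suc N) s            ≤⟨ +-monoʳ-≤ (u * A N s) small ⟩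
      u * A N s + c * u ^ suc N                     ∎)))
    where
    open ≤-Reasoning
    l : ∀ u c n e → u * (c * suc n * e) + c * (u * e) ≡ c * suc (suc n) * (u * e)
    l = solve-∀

  growth : ∀ c k → u ≤ v * c → T (c * suc (walkLength k) * D <ᵇ get (proj₁ (weights k)) 1) →
    ∃ λ n → u ^ suc n ≤ v ^ suc n * Z (suc n) []
  growth c k u≤vc check with pigeonhole c (1 ∷ []) (walkLength k) large
    where
    K = walkLength k
    p₁ = get (proj₁ (weights k)) 1
    open ≤-Reasoning
    large : c * suc K * u ^ K < A K (1 ∷ [])
    large = *-cancelˡ-< D _ _ (begin-strict
      D * (c * suc K * u ^ K)     ≡⟨ trans (sym (*-assoc D (c * suc K) _)) (cong (_* u ^ K) (*-comm D (c * suc K))) ⟩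
      c * suc K * D * u ^ K       <⟨ *-monoˡ-< (u ^ K) {{m^n≢0 u K}} (<ᵇ⇒< (c * suc K * D) p₁ check) ⟩
      p₁ * u ^ K                  ≡⟨ cong (p₁ *_) (sym (*-identityʳ (u ^ K))) ⟩
      p₁ * (u ^ K * 1)            ≤⟨ proj₁ (weights-sound k) 0 1 [] ⟩
      D * A (K + 0) (1 ∷ [])      ≡⟨ cong (λ x → D * A x (1 ∷ [])) (+-identityʳ K) ⟩
      D * A K (1 ∷ []) ∎)
  ... | n , lt = n , (begin
      u * u ^ n                       ≤⟨ *-monoˡ-≤ (u ^ n) u≤vc ⟩
      v * c * u ^ n                   ≡⟨ *-assoc v c (u ^ n) ⟩
      v * (c * u ^ n)                 ≤⟨ *-monoʳ-≤ v (<⇒≤ lt) ⟩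
      v * (v ^ n * Z n (1 ∷ []))      ≡⟨ sym (*-assoc v (v ^ n) _) ⟩
      v ^ suc n * Z n (1 ∷ [])        ≡⟨ cong (v ^ suc n *_) (sym (+-identityʳ _)) ⟩
      v ^ suc n * Z (suc n) []        ∎)
      where open ≤-Reasoning

-- The iterates speak of walks of length 2¹⁴³ - 1. The factor 8 > 39/5 pays for the first insertion.
Z-growth : ∃ λ n → 39 ^ suc n ≤ 5 ^ suc n * Z (suc n) []
Z-growth = Kleene.growth 39 5 10000 8 143 (≤ᵇ⇒≤ 39 40 _) _

-- Patterns and insertions

Word : Set
Word = List ℕ

Has231 Has1342 Has12453 : Word → Set
Has231 w   = ∃ λ b → ∃ λ c → ∃ λ a → b ∷ c ∷ a ∷ [] ⊆ w × a < b × b < c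
Has1342 w  = ∃ λ a → ∃ λ c → ∃ λ d → ∃ λ b → a ∷ c ∷ d ∷ b ∷ [] ⊆ w × a < b × b < c × c < d
Has12453 w = ∃ λ a → ∃ λ b → ∃ λ d → ∃ λ e → ∃ λ c →
  a ∷ b ∷ d ∷ e ∷ c ∷ [] ⊆ w × a < b × b < c × c < d × d < e

Has231-⊆ : ∀ {v w} → v ⊆ w → Has231 v → Has231 w
Has231-⊆ v⊆w (b , c , a , s , o) = b , c , a , ⊆-trans s v⊆w , o

Has1342-⊆ : ∀ {v w} → v ⊆ w → Has1342 v → Has1342 w
Has1342-⊆ v⊆w (a , c , d , b , s , o) = a , c , d , b , ⊆-trans s v⊆w , o

infix 4 _≺_
_≺_ : ℕ → Word → Set
v ≺ w = ∀ {x} → x ∈ w → v < x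

∈-⊆ : ∀ {x : ℕ} {v w} → v ⊆ w → x ∈ v → x ∈ w
∈-⊆ = Any-resp-⊆

∈-insert⁻ : ∀ {x v : ℕ} ys {zs} → x ∈ ys ++ v ∷ zs → x ≡ v ⊎ x ∈ ys ++ zs
∈-insert⁻ ys x∈ with ∈-++⁻ ys x∈
... | inj₁ p         = inj₂ (∈-++⁺ˡ p)
... | inj₂ (here e)  = inj₁ e
... | inj₂ (there p) = inj₂ (∈-++⁺ʳ ys p)

⊆-++⁻ : ∀ xs {ys s : Word} → s ⊆ xs ++ ys → ∃₂ λ s₁ s₂ → s ≡ s₁ ++ s₂ × s₁ ⊆ xs × s₂ ⊆ ys
⊆-++⁻ []       p          = [] , _ , refl , [] , p
⊆-++⁻ (x ∷ xs) (.x ∷ʳ p)  with ⊆-++⁻ xs p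
... | s₁ , s₂ , eq , p₁ , p₂ = s₁ , s₂ , eq , x ∷ʳ p₁ , p₂
⊆-++⁻ (x ∷ xs) (e ∷ p) with ⊆-++⁻ xs p
... | s₁ , s₂ , eq , p₁ , p₂ = _ ∷ s₁ , s₂ , cong (_ ∷_) eq , e ∷ p₁ , p₂

⊆-insert⁻ : ∀ ys {zs s : Word} {v} → s ⊆ ys ++ v ∷ zs →
  s ⊆ ys ++ zs ⊎ (∃₂ λ s₁ s₂ → s ≡ s₁ ++ v ∷ s₂ × s₁ ⊆ ys × s₂ ⊆ zs)
⊆-insert⁻ ys p with ⊆-++⁻ ys p
... | s₁ , s₂     , refl , p₁ , (_ ∷ʳ p₂)    = inj₁ (++⁺ p₁ p₂)
... | s₁ , _ ∷ s₂ , refl , p₁ , (refl ∷ p₂) = inj₂ (s₁ , s₂ , refl , p₁ , p₂)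

-- A pattern starting with its minimum can only use a new minimum of the word in that rôle.
⊆-insert-min : ∀ ys {zs s : Word} {a v} → a ∷ s ⊆ ys ++ v ∷ zs → All (a <_) s → v ≺ ys ++ zs →
  a ∷ s ⊆ ys ++ zs ⊎ s ⊆ zs
⊆-insert-min ys p a< v≺ with ⊆-insert⁻ ys p
... | inj₁ q                              = inj₁ q
... | inj₂ ([] , s₂ , refl , _ , q)       = inj₂ q
... | inj₂ (a ∷ s₁ , s₂ , refl , q , _)   =
  ⊥-elim (<-asym (v≺ (∈-++⁺ˡ (to∈ q))) (All.lookup a< (∈-++⁺ʳ s₁ (here refl))))

av12453-insert : ∀ ys {zs v} → v ≺ ys ++ zs → ¬ Has1342 zs → ¬ Has12453 (ys ++ zs) → ¬ Has12453 (ys ++ v ∷ zs)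
av12453-insert ys v≺ nz n (a , b , d , e , c , s , ab , bc , cd , de)
  with ⊆-insert-min ys s (ab ∷ <-trans ab (<-trans bc cd) ∷ <-trans ab (<-trans bc (<-trans cd de)) ∷ <-trans ab bc ∷ []) v≺
... | inj₁ q = n (a , b , d , e , c , q , ab , bc , cd , de)
... | inj₂ q = nz (b , d , e , c , q , bc , cd , de)

av1342-insert : ∀ ys {zs v} → v ≺ ys ++ zs → ¬ Has231 zs → ¬ Has1342 (ys ++ zs) → ¬ Has1342 (ys ++ v ∷ zs)
av1342-insert ys v≺ nz n (a , c , d , b , s , ab , bc , cd)
  with ⊆-insert-min ys s (<-trans ab bc ∷ <-trans ab (<-trans bc cd) ∷ ab ∷ []) v≺
... | inj₁ q = n (a , c , d , b , q , ab , bc , cd)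
... | inj₂ q = nz (c , d , b , q , bc , cd)

Descending : Word → Set
Descending = AllPairs _>_

pair∉descending : ∀ {b c w} → Descending w → b ∷ c ∷ [] ⊆ w → ¬ b < c
pair∉descending (_ ∷ d)  (_ ∷ʳ s)   = pair∉descending d s
pair∉descending (gt ∷ d) (refl ∷ s) = <-asym (All.lookup gt (to∈ s))

-- A new minimum can only play the 1 of 231, and then the 2 and the 3 would form an ascent in `ys`.
av231-insert : ∀ ys {zs v} → v ≺ ys ++ zs → Descending ys → ¬ Has231 (ys ++ zs) → ¬ Has231 (ys ++ v ∷ zs)
av231-insert ys v≺ dec n (b , c , a , s , ab , bc) with ⊆-insert⁻ ys s
... | inj₁ q = n (b , c , a , q , ab , bc)
... | inj₂ ([] , _ , refl , _ , q)                     = <-asym ab (v≺ (∈-++⁺ʳ ys (∈-⊆ q (there (here refl)))))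
... | inj₂ (b ∷ [] , _ , refl , q , _)                 = <-asym bc (v≺ (∈-++⁺ˡ (to∈ q)))
... | inj₂ (b ∷ c ∷ [] , _ , refl , q , _)             = pair∉descending dec q bc
... | inj₂ (b ∷ c ∷ _ ∷ [] , _ , () , _ , _)
... | inj₂ (b ∷ c ∷ _ ∷ _ ∷ _ , _ , () , _ , _)

-- 1342 is skew-indecomposable.
av1342-skew : ∀ xs {ys} → (∀ {x} → x ∈ xs → ∀ {y} → y ∈ ys → y < x) →
  ¬ Has1342 xs → ¬ Has1342 ys → ¬ Has1342 (xs ++ ys)
av1342-skew xs gt nx ny (a , c , d , b , s , ab , bc , cd) with ⊆-++⁻ xs s
... | [] , _ , refl , _ , q = ny (a , c , d , b , q , ab , bc , cd)
... | a ∷ [] , _ , refl , p , q          = <-asym ab (gt (to∈ p) (∈-⊆ q (there (there (here refl)))))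
... | a ∷ c ∷ [] , _ , refl , p , q      = <-asym ab (gt (to∈ p) (∈-⊆ q (there (here refl))))
... | a ∷ c ∷ d ∷ [] , _ , refl , p , q  = <-asym ab (gt (to∈ p) (∈-⊆ q (here refl)))
... | a ∷ c ∷ d ∷ b ∷ [] , _ , refl , p , q = nx (a , c , d , b , p , ab , bc , cd)
... | a ∷ c ∷ d ∷ b ∷ _ ∷ _ , _ , () , p , q

-- Words avoiding 1342

private variable
  X : Set

flat : Word → List Word → Word
flat z rs = z ++ concat rs

-- `splits` and `pops` follow the recursion of `splitSum` and `popSum`, with words in place of
-- lengths: `w` holds the letters of the run already passed, and `f` is the recursive call.
splits : (Word → List Word → List X) → ℕ → Word → Word → Word → List Word → List X
splits f v z w []      rs = []
splits f v z w (x ∷ r) rs = f z ((w ++ x ∷ v ∷ []) ∷ r ∷ rs) ++ splits f v z (w ++ [ x ]) r rs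

pops : (Word → List Word → List X) → ℕ → Word → List Word → List X
pops f v z []       = []
pops f v z (r ∷ rs) = splits f v z [] r rs ++ pops f v (z ++ r) rs

-- In flat z rs, the descending runs of the longest suffix avoiding 231 are those in rs.
gen : Word → Word → List Word → List Word
gen []       z rs = [ flat z rs ]
gen (v ∷ vs) z rs = gen vs z ([ v ] ∷ rs) ++ pops (gen vs) v z rs

length-gen : ∀ vs z rs → length (gen vs z rs) ≡ Z (length vs) (map length rs)
length-gen []       z rs = refl
length-gen (v ∷ vs) z rs = trans (length-++ (gen vs z ([ v ] ∷ rs))) (cong₂ _+_ (length-gen vs z ([ v ] ∷ rs)) (onPops z rs))
  where
  f = Z (length vs)
  onSplits : ∀ z w r rs → length (splits (gen vs) v z w r rs) ≡ splitSum f (length w) (length r) (map length rs)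
  onSplits z w []      rs = refl
  onSplits z w (x ∷ r) rs = trans (length-++ (gen vs z ((w ++ x ∷ v ∷ []) ∷ r ∷ rs)))
    (cong₂ _+_ (trans (length-gen vs z ((w ++ x ∷ v ∷ []) ∷ r ∷ rs))
                 (cong (λ l → f (l ∷ length r ∷ map length rs)) (trans (length-++ w) (+-comm (length w) 2))))
               (trans (onSplits z (w ++ [ x ]) r rs)
                 (cong (λ l → splitSum f l (length r) (map length rs)) (trans (length-++ w) (+-comm (length w) 1)))))
  onPops : ∀ z rs → length (pops (gen vs) v z rs) ≡ popSum f (map length rs)
  onPops z []       = refl
  onPops z (r ∷ rs) = trans (length-++ (splits (gen vs) v z [] r rs)) (cong₂ _+_ (onSplits z [] r rs) (onPops (z ++ r) rs))

++-split : ∀ (xs {ys} as {bs} : Word) → xs ++ ys ≡ as ++ bs →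
  (∃ λ m → xs ≡ as ++ m × bs ≡ m ++ ys) ⊎ (∃₂ λ x m → as ≡ xs ++ x ∷ m × ys ≡ x ∷ m ++ bs)
++-split xs       []       eq = inj₁ (xs , refl , sym eq)
++-split []       (a ∷ as) eq = inj₂ (a , as , refl , eq)
++-split (x ∷ xs) (a ∷ as) eq with ∷-injective eq
... | refl , eq′ with ++-split xs as eq′
...   | inj₁ (m , refl , e)     = inj₁ (m , refl , e)
...   | inj₂ (y , m , refl , e) = inj₂ (y , m , refl , e)

insert-split : ∀ (p : Word) {v} (r₂ z₁ : Word) {x} (z₂ : Word) → p ++ v ∷ r₂ ≡ z₁ ++ x ∷ z₂ → v ∈ x ∷ z₂ ⊎ (∃ λ m → r₂ ≡ m ++ x ∷ z₂)
insert-split []      r₂ []       z₂ refl = inj₁ (here refl)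
insert-split []      r₂ (y ∷ z₁) z₂ refl = inj₂ (z₁ , refl)
insert-split (y ∷ p) r₂ []       z₂ refl = inj₁ (there (∈-++⁺ʳ p (here refl)))
insert-split (y ∷ p) r₂ (_ ∷ z₁) z₂ eq   = insert-split p r₂ z₁ z₂ (proj₂ (∷-injective eq))

-- No suffix avoiding 231 starts inside `z`. Hence, by `locate`, a minimum that creates no 1342
-- cannot be inserted before the end of `z`.
Maximal : Word → List Word → Set
Maximal z rs = ∀ z₁ x z₂ → z ≡ z₁ ++ x ∷ z₂ → Has231 (x ∷ z₂ ++ concat rs)

-- Once a new minimum is inserted behind an element of r, every suffix reaching into z contains 231.
Blocked : Word → Word → List Word → Set
Blocked z r rs = ∀ z₁ x z₂ → z ≡ z₁ ++ x ∷ z₂ → ∀ h t → r ≡ h ∷ t →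
  Any (_< h) (x ∷ z₂) ⊎ Has231 (x ∷ z₂ ++ concat (r ∷ rs))

AllBlocked : Word → List Word → Set
AllBlocked z []       = ⊤
AllBlocked z (r ∷ rs) = Blocked z r rs × AllBlocked (z ++ r) rs

maximal⇒blocked : ∀ {z r rs} → Maximal z (r ∷ rs) → Blocked z r rs
maximal⇒blocked max z₁ x z₂ eq _ _ _ = inj₂ (max z₁ x z₂ eq)

-- A suffix reaching back to `v` contains a letter below every later head, namely `v`; a suffix
-- starting behind `v` was already blocked.
allBlocked-insert : ∀ p v r₂ rs → v ≺ concat rs → AllBlocked (p ++ r₂) rs → AllBlocked (p ++ v ∷ r₂) rs
allBlocked-insert p v r₂ []       v≺ _       = _
allBlocked-insert p v r₂ (r ∷ rs) v≺ (b , bs) = new ,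
  subst (λ z → AllBlocked z rs) (sym (++-assoc p (v ∷ r₂) r))
    (allBlocked-insert p v (r₂ ++ r) rs (λ y∈ → v≺ (∈-++⁺ʳ r y∈))
      (subst (λ z → AllBlocked z rs) (++-assoc p r₂ r) bs))
  where
  new : Blocked (p ++ v ∷ r₂) r rs
  new z₁ x z₂ eq h t eqr with insert-split p r₂ z₁ z₂ eq
  ... | inj₁ v∈        = inj₁ (Any.map (λ { refl → v≺ (∈-++⁺ˡ (subst (h ∈_) (sym eqr) (here refl))) }) v∈)
  ... | inj₂ (m , e) = b (p ++ m) x z₂ (trans (cong (p ++_) e) (sym (++-assoc p m (x ∷ z₂)))) h t eqr

maximal-push : ∀ {z rs} v → Maximal z rs → Maximal z ([ v ] ∷ rs)
maximal-push v max z₁ x z₂ eq = Has231-⊆ (refl ∷ ++⁺ (⊆-refl {x = z₂}) (v ∷ʳ ⊆-refl)) (max z₁ x z₂ eq)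

allBlocked-push : ∀ {z rs} v → v ≺ concat rs → Maximal z rs → AllBlocked z rs → AllBlocked z ([ v ] ∷ rs)
allBlocked-push {z} {rs} v v≺ max bs =
  maximal⇒blocked {rs = rs} (maximal-push {rs = rs} v max) ,
  allBlocked-insert z v [] rs v≺ (subst (λ z → AllBlocked z rs) (sym (++-identityʳ z)) bs)

module _ (z : Word) (h : ℕ) (t r₂ : Word) (rs : List Word) (v : ℕ)
         (v≺ : v ≺ flat z ((h ∷ t ++ r₂) ∷ rs)) (b : Blocked z (h ∷ t ++ r₂) rs) where

  -- Either the suffix has a letter y < h, and then y, h, v form a 231, or it contained a 231
  -- before, which survives the insertion.
  maximal-split : Maximal z ((h ∷ t ++ [ v ]) ∷ r₂ ∷ rs)
  maximal-split z₁ x z₂ eq with b z₁ x z₂ eq h (t ++ r₂) refl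
  ... | inj₂ has = Has231-⊆ (refl ∷ ++⁺ (⊆-refl {x = z₂}) (refl ∷
          ⊆-trans (⊆-reflexive (++-assoc t r₂ (concat rs)))
          (⊆-trans (++⁺ (⊆-refl {x = t}) (v ∷ʳ ⊆-refl)) (⊆-reflexive (sym (++-assoc t [ v ] (r₂ ++ concat rs))))))) has
  ... | inj₁ any with find any
  ... | y , y∈ , y<h = y , h , v , ++⁺ (from∈ y∈) (refl ∷ ++⁺ʳ (concat (r₂ ∷ rs)) (++⁺ˡ t ⊆-refl)) ,
          v≺ (∈-++⁺ˡ (subst (y ∈_) (sym eq) (∈-++⁺ʳ z₁ y∈))) , y<h

  allBlocked-split : AllBlocked (z ++ h ∷ t ++ r₂) rs → AllBlocked z ((h ∷ t ++ [ v ]) ∷ r₂ ∷ rs)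
  allBlocked-split bs = maximal⇒blocked {rs = r₂ ∷ rs} maximal-split , second ,
    subst (λ u → AllBlocked u rs) eq₁
      (allBlocked-insert (z ++ h ∷ t) v r₂ rs
        (λ y∈ → v≺ (∈-++⁺ʳ z (there (∈-++⁺ʳ (t ++ r₂) y∈))))
        (subst (λ u → AllBlocked u rs) (sym (++-assoc z (h ∷ t) r₂)) bs))
    where
    eq₁ : (z ++ h ∷ t) ++ v ∷ r₂ ≡ (z ++ h ∷ t ++ [ v ]) ++ r₂
    eq₁ = trans (++-assoc z (h ∷ t) (v ∷ r₂)) (trans (cong (λ u → z ++ h ∷ u) (sym (++-assoc t [ v ] r₂)))
      (sym (++-assoc z (h ∷ t ++ [ v ]) r₂)))
    second : Blocked (z ++ h ∷ t ++ [ v ]) r₂ rs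
    second z₁ x z₂ eq h₂ t₂ refl with insert-split (z ++ h ∷ t) [] z₁ z₂ (trans (++-assoc z (h ∷ t) [ v ]) eq)
    ... | inj₁ v∈ = inj₁ (Any.map (λ { refl → v≺ (∈-++⁺ʳ z (there (∈-++⁺ˡ (∈-++⁺ʳ t (here refl))))) }) v∈)
    ... | inj₂ (m , e) = ⊥-elim (nonempty m e)
      where
      nonempty : ∀ m → [] ≢ m ++ x ∷ z₂
      nonempty []      ()
      nonempty (_ ∷ _) ()

locate : ∀ ys {zs} z rs → ys ++ zs ≡ flat z rs → Maximal z rs → ¬ Has231 zs →
  ∃ λ m → ys ≡ z ++ m × m ++ zs ≡ concat rs
locate ys z rs eq max n with ++-split ys z eq
... | inj₁ (m , e₁ , e₂)           = m , e₁ , sym e₂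
... | inj₂ (x , m , e₁ , refl)     = ⊥-elim (n (max ys x m e₁))

⊆-extend : ∀ {u p : Word} {v} → u ⊆ p → v ∈ p → v ∉ u → ∃₂ λ ys zs → u ≡ ys ++ zs × ys ++ v ∷ zs ⊆ p
⊆-extend {u} (y ∷ʳ s)   (here refl) v∉ = [] , u , refl , refl ∷ s
⊆-extend     (y ∷ʳ s)   (there v∈)  v∉ with ⊆-extend s v∈ v∉
... | ys , zs , eq , s′ = ys , zs , eq , y ∷ʳ s′
⊆-extend     (refl ∷ s) (here refl) v∉ = ⊥-elim (v∉ (here refl))
⊆-extend     (_∷_ {x = x} refl s) (there v∈)  v∉ with ⊆-extend s v∈ (λ i → v∉ (there i))
... | ys , zs , refl , s′ = x ∷ ys , zs , refl , refl ∷ s′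

∈-splits : ∀ f v z w h t r₂ rs {p : Word} →
  p ∈ f z ((w ++ h ∷ t ++ [ v ]) ∷ r₂ ∷ rs) → p ∈ splits f v z w (h ∷ t ++ r₂) rs
∈-splits f v z w h []       r₂ rs p∈ = ∈-++⁺ˡ p∈
∈-splits f v z w h (h′ ∷ t) r₂ rs p∈ = ∈-++⁺ʳ (f z _)
  (∈-splits f v z (w ++ [ h ]) h′ t r₂ rs (subst (λ u → _ ∈ f z (u ∷ r₂ ∷ rs)) (sym (++-assoc w [ h ] (h′ ∷ t ++ [ v ]))) p∈))

record Between (vs z : Word) (rs : List Word) (p : Word) : Set where
  field
    descending : Descending vs
    below      : All (λ v → v ≺ flat z rs) vs
    sublist    : flat z rs ⊆ p
    remaining  : All (_∈ p) vs
    count      : length p ≡ length vs + length (flat z rs)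

-- The letters of `p` enter in descending order, so `flat z rs` is a subword of `p` with letters
-- above all of `vs`. A 231 behind `v` would complete a 1342 in `p`; so `v` belongs at one of the
-- places that `gen` tries. Once `vs` is used up the lengths agree, and the subword is `p`.
gen-complete : ∀ vs z rs {p} → ¬ Has1342 p → Maximal z rs → AllBlocked z rs → Between vs z rs p → p ∈ gen vs z rs
gen-complete [] z rs av max bs bt = here (sym (Pointwise-≡⇒≡ (to-≋ (sym (Between.count bt)) (Between.sublist bt))))
gen-complete (v ∷ vs) z rs {p} av max bs record
  { descending = v> ∷ desc ; below = v≺ ∷ vs≺ ; sublist = u⊆p ; remaining = v∈ ∷ vs∈ ; count = cnt }
  with ⊆-extend u⊆p v∈ (λ i → <-irrefl refl (v≺ i))
... | ys , zs , eq , new⊆p with locate ys z rs (sym eq) max zs-avoids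
  where
  zs-avoids : ¬ Has231 zs
  zs-avoids (b , c , a , s , ab , bc) = av (v , b , c , a ,
    ⊆-trans (refl ∷ s) (⊆-trans (++⁺ˡ ys ⊆-refl) new⊆p) ,
    v≺ (subst (a ∈_) (sym eq) (∈-++⁺ʳ ys (to∈ (∷ˡ⁻ (∷ˡ⁻ s))))) , ab , bc)
... | m , refl , m++zs = insertAfter m refl m++zs
  where
  continue : ∀ z′ rs′ → flat z′ rs′ ≡ (z ++ m) ++ v ∷ zs → Between vs z′ rs′ p
  continue z′ rs′ eq′ = record
    { descending = desc
    ; below      = All.zipWith (λ { (u≺ , u<v) {x} x∈ → case-new u≺ u<v (∈-insert⁻ (z ++ m) (subst (x ∈_) eq′ x∈)) }) (vs≺ , v>)
    ; sublist    = subst (_⊆ p) (sym eq′) new⊆p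
    ; remaining  = vs∈
    ; count      = trans cnt (trans (sym (+-suc (length vs) _)) (cong (length vs +_) (sym (trans (cong length eq′) length-new))))
    }
    where
    case-new : ∀ {u x} → u ≺ flat z rs → u < v → x ≡ v ⊎ x ∈ (z ++ m) ++ zs → u < x
    case-new u≺ u<v (inj₁ refl) = u<v
    case-new u≺ u<v (inj₂ x∈)   = u≺ (subst (_ ∈_) (sym eq) x∈)
    length-new : length ((z ++ m) ++ v ∷ zs) ≡ suc (length (flat z rs))
    length-new = trans (length-++ (z ++ m)) (trans (+-suc (length (z ++ m)) (length zs))
      (cong suc (trans (sym (length-++ (z ++ m))) (cong length (sym eq)))))

  atSplit : ∀ y r ss h t r₂ → flat y (r ∷ ss) ≡ flat z rs → AllBlocked y (r ∷ ss) → r ≡ h ∷ t ++ r₂ →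
    zs ≡ r₂ ++ concat ss → y ++ h ∷ t ≡ z ++ m → p ∈ pops (gen vs) v y (r ∷ ss)
  atSplit y _ ss h t r₂ fl (b , bl) refl e e′ = ∈-++⁺ˡ (∈-splits (gen vs) v y [] h t r₂ ss
    (gen-complete vs y ((h ∷ t ++ [ v ]) ∷ r₂ ∷ ss) av
      (maximal-split y h t r₂ ss v v≺′ b) (allBlocked-split y h t r₂ ss v v≺′ b bl)
      (continue y ((h ∷ t ++ [ v ]) ∷ r₂ ∷ ss) eq′)))
    where
    v≺′ : v ≺ flat y ((h ∷ t ++ r₂) ∷ ss)
    v≺′ x∈ = v≺ (subst (_ ∈_) fl x∈)
    eq′ : y ++ (h ∷ t ++ [ v ]) ++ r₂ ++ concat ss ≡ (z ++ m) ++ v ∷ zs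
    eq′ = trans (cong (λ u → y ++ h ∷ u) (trans (++-assoc t [ v ] (r₂ ++ concat ss)) (cong (λ u → t ++ v ∷ u) (sym e))))
      (trans (sym (++-assoc y (h ∷ t) (v ∷ zs))) (cong (_++ v ∷ zs) e′))

  -- `h ∷ t` is the part of `m` not yet passed; the run in which it ends is the one to split. If it
  -- ends with the run, the split leaves a run of length 0.
  inPops : ∀ y ss h t → flat y ss ≡ flat z rs → AllBlocked y ss → h ∷ t ++ zs ≡ concat ss → y ++ h ∷ t ≡ z ++ m →
    p ∈ pops (gen vs) v y ss
  inPops y (r ∷ ss) h t fl (b , bl) e e′ with ++-split (h ∷ t) r e
  ... | inj₁ (h′ ∷ t′ , e₁ , e₂) = ∈-++⁺ʳ (splits (gen vs) v y [] r ss)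
        (inPops (y ++ r) ss h′ t′ (trans (++-assoc y r (concat ss)) fl) bl (sym e₂)
          (trans (++-assoc y r (h′ ∷ t′)) (trans (cong (y ++_) (sym e₁)) e′)))
  ... | inj₁ ([] , e₁ , e₂) = atSplit y r ss h t [] fl (b , bl)
          (trans (sym (++-identityʳ r)) (trans (sym e₁) (cong (h ∷_) (sym (++-identityʳ t))))) (sym e₂) e′
  ... | inj₂ (x , r₂ , e₁ , e₂) = atSplit y r ss h t (x ∷ r₂) fl (b , bl) e₁ e₂ e′

  insertAfter : ∀ m′ → m′ ≡ m → m′ ++ zs ≡ concat rs → p ∈ gen (v ∷ vs) z rs
  insertAfter [] e e₂ = ∈-++⁺ˡ (gen-complete vs z ([ v ] ∷ rs) av (maximal-push {rs = rs} v max)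
    (allBlocked-push v (λ y∈ → v≺ (∈-++⁺ʳ z y∈)) max bs)
    (continue z ([ v ] ∷ rs) (trans (cong (λ u → z ++ v ∷ u) (sym e₂))
      (cong (_++ v ∷ zs) (trans (sym (++-identityʳ z)) (cong (z ++_) e))))))
  insertAfter (h ∷ t) e e₂ = ∈-++⁺ʳ (gen vs z ([ v ] ∷ rs)) (inPops z rs h t refl bs e₂ (cong (z ++_) e))

-- The permutations counted by S

module _ {A B : Set} where

  unique-concatMap : ∀ {f : A → List B} {xs} → Unique xs → (∀ {x} → x ∈ xs → Unique (f x)) →
    (∀ {x y z} → x ∈ xs → y ∈ xs → z ∈ f x → z ∈ f y → x ≡ y) → Unique (concatMap f xs)
  unique-concatMap {xs = []} [] _ _ = []
  unique-concatMap {f} {x ∷ xs} u@(_ ∷ us) uf inj = Unique.++⁺ (uf (here refl))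
    (unique-concatMap us (uf ∘ there) (λ p q → inj (there p) (there q)))
    λ { (z∈fx , z∈rest) → let (y , y∈ , z∈fy) = find (∈-concatMap⁻ f z∈rest) in
        Unique[x∷xs]⇒x∉xs u (subst (_∈ xs) (sym (inj (here refl) (there y∈) z∈fx z∈fy)) y∈) }

unique-⊆-length : ∀ {A : Set} {xs ys : List A} → Unique xs → (∀ {x} → x ∈ xs → x ∈ ys) → length xs ≤ length ys
unique-⊆-length {xs = []} _ _ = z≤n
unique-⊆-length {xs = x ∷ xs} u@(_ ∷ us) sub with ∈-∃++ (sub (here refl))
... | as , bs , refl = ≤-trans (s≤s (unique-⊆-length us rest))
    (≤-reflexive (trans (cong suc (length-++ as)) (trans (sym (+-suc (length as) (length bs))) (sym (length-++ as)))))
  where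
  rest : ∀ {y} → y ∈ xs → y ∈ as ++ bs
  rest {y} y∈ with ∈-++⁻ as (sub (there y∈))
  ... | inj₁ p           = ∈-++⁺ˡ p
  ... | inj₂ (here refl) = ⊥-elim (Unique[x∷xs]⇒x∉xs u y∈)
  ... | inj₂ (there p)   = ∈-++⁺ʳ as p

-- The concatenation used by subseqs is local to its where block: it is named by unification.
mutual
  append : ℕ → ℕ → List ℕ → List (List ℕ) → List (List ℕ) → List (List ℕ)
  append = _

  subseqs-∷ : ∀ k x w → subseqs (suc k) (x ∷ w) ≡ append k x w (map (List._∷_ x) (subseqs k w)) (subseqs (suc k) w)
  subseqs-∷ k x w with map (List._∷_ x) (subseqs k w) | subseqs (suc k) w
  ... | ss | ts = refl

append≡++ : ∀ k x w ss ts → append k x w ss ts ≡ ss ++ ts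
append≡++ k x w []       ts = refl
append≡++ k x w (s ∷ ss) ts = cong (s ∷_) (append≡++ k x w ss ts)

subseqs≡ : ∀ k x w → subseqs (suc k) (x ∷ w) ≡ map (x ∷_) (subseqs k w) ++ subseqs (suc k) w
subseqs≡ k x w = trans (subseqs-∷ k x w) (append≡++ k x w (map (List._∷_ x) (subseqs k w)) (subseqs (suc k) w))

∈-subseqs⁺ : ∀ {s w} → s ⊆ w → s ∈ subseqs (length s) w
∈-subseqs⁺ {[]}    _  = here refl
∈-subseqs⁺ {x ∷ s} {y ∷ w} (.y ∷ʳ p)  = subst (_ ∈_) (sym (subseqs≡ (length s) y w)) (∈-++⁺ʳ _ (∈-subseqs⁺ p))
∈-subseqs⁺ {x ∷ s} {y ∷ w} (refl ∷ p) = subst (_ ∈_) (sym (subseqs≡ (length s) y w)) (∈-++⁺ˡ (∈-map⁺ (x ∷_) (∈-subseqs⁺ p)))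

∈-subseqs⁻ : ∀ k w {s} → s ∈ subseqs k w → s ⊆ w × length s ≡ k
∈-subseqs⁻ zero    w       (here refl) = minimum w , refl
∈-subseqs⁻ (suc k) (x ∷ w) s∈ with ∈-++⁻ (map (x ∷_) (subseqs k w)) (subst (_ ∈_) (subseqs≡ k x w) s∈)
... | inj₂ p = let (s⊆ , len) = ∈-subseqs⁻ (suc k) w p in x ∷ʳ s⊆ , len
... | inj₁ p with ∈-map⁻ (x ∷_) p
... | t , t∈ , refl = let (t⊆ , len) = ∈-subseqs⁻ k w t∈ in refl ∷ t⊆ , cong suc len

<⇒<ᵇ≡true : ∀ {m n} → m < n → (m <ᵇ n) ≡ true
<⇒<ᵇ≡true {m} {n} lt with m <ᵇ n | <⇒<ᵇ lt
... | true | _ = refl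

≥⇒<ᵇ≡false : ∀ {m n} → n ≤ m → (m <ᵇ n) ≡ false
≥⇒<ᵇ≡false {m} {n} le with m <ᵇ n | <ᵇ⇒< m n
... | false | _ = refl
... | true  | f = ⊥-elim (<⇒≱ (f tt) le)

orderIso-12453⁺ : ∀ {a b c d e} → a < b → b < c → c < d → d < e → T (orderIso (a ∷ b ∷ d ∷ e ∷ c ∷ []) q12453)
orderIso-12453⁺ {a} {b} {c} {d} {e} ab bc cd de
  rewrite ≥⇒<ᵇ≡false (≤-refl {a}) | ≥⇒<ᵇ≡false (≤-refl {b}) | ≥⇒<ᵇ≡false (≤-refl {c}) | ≥⇒<ᵇ≡false (≤-refl {d}) | ≥⇒<ᵇ≡false (≤-refl {e})
        | <⇒<ᵇ≡true ab | <⇒<ᵇ≡true bc | <⇒<ᵇ≡true cd | <⇒<ᵇ≡true de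
        | <⇒<ᵇ≡true (<-trans ab bc) | <⇒<ᵇ≡true (<-trans bc cd) | <⇒<ᵇ≡true (<-trans cd de)
        | <⇒<ᵇ≡true (<-trans ab (<-trans bc cd)) | <⇒<ᵇ≡true (<-trans bc (<-trans cd de))
        | <⇒<ᵇ≡true (<-trans ab (<-trans bc (<-trans cd de)))
        | ≥⇒<ᵇ≡false (<⇒≤ ab) | ≥⇒<ᵇ≡false (<⇒≤ bc) | ≥⇒<ᵇ≡false (<⇒≤ cd) | ≥⇒<ᵇ≡false (<⇒≤ de)
        | ≥⇒<ᵇ≡false (<⇒≤ (<-trans ab bc)) | ≥⇒<ᵇ≡false (<⇒≤ (<-trans bc cd)) | ≥⇒<ᵇ≡false (<⇒≤ (<-trans cd de))
        | ≥⇒<ᵇ≡false (<⇒≤ (<-trans ab (<-trans bc cd))) | ≥⇒<ᵇ≡false (<⇒≤ (<-trans bc (<-trans cd de)))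
        | ≥⇒<ᵇ≡false (<⇒≤ (<-trans ab (<-trans bc (<-trans cd de)))) = tt

-- The λ-abstractions inside orderIso, named by unification as well.
mutual
  isoRow : Word → Word → ℕ × ℕ → Bool
  isoRow = _

  isoEntry : Word → Word → ℕ → ℕ → ℕ × ℕ → Bool
  isoEntry = _

  orderIso≡ : ∀ s q → orderIso s q ≡ all (isoRow s q) (zip s q)
  orderIso≡ s q = refl

  isoRow≡ : ∀ s q x₁ x₂ → isoRow s q (x₁ , x₂) ≡ all (isoEntry s q x₁ x₂) (zip s q)
  isoRow≡ s q x₁ x₂ = refl

isoEntry-sound : ∀ s q x₁ x₂ y₁ y₂ → T (isoEntry s q x₁ x₂ (y₁ , y₂)) → (x₁ <ᵇ y₁) ≡ (x₂ <ᵇ y₂)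
isoEntry-sound s q x₁ x₂ y₁ y₂ t with x₁ <ᵇ y₁ | x₂ <ᵇ y₂ | t
... | true  | true  | _ = refl
... | false | false | _ = refl

orderIso-sound : ∀ s q → T (orderIso s q) → ∀ {x₁ x₂ y₁ y₂} → (x₁ , x₂) ∈ zip s q → (y₁ , y₂) ∈ zip s q →
  (x₁ <ᵇ y₁) ≡ (x₂ <ᵇ y₂)
orderIso-sound s q t {x₁} {x₂} {y₁} {y₂} x∈ y∈ = isoEntry-sound s q x₁ x₂ y₁ y₂
  (All.lookup (all⁺ (isoEntry s q x₁ x₂) (zip s q) (All.lookup (all⁺ (isoRow s q) (zip s q) t) x∈)) y∈)

orderIso-12453⁻ : ∀ {a b c d e} → T (orderIso (a ∷ b ∷ d ∷ e ∷ c ∷ []) q12453) → a < b × b < c × c < d × d < e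
orderIso-12453⁻ {a} {b} {c} {d} {e} t =
  smaller (here refl) (there (here refl)) , smaller (there (here refl)) c∈ , smaller c∈ d∈ , smaller d∈ (there (there (there (here refl))))
  where
  z = zip (a ∷ b ∷ d ∷ e ∷ c ∷ []) q12453
  c∈ : (c , 3) ∈ z
  c∈ = there (there (there (there (here refl))))
  d∈ : (d , 4) ∈ z
  d∈ = there (there (here refl))
  smaller : ∀ {x i y j} → (x , i) ∈ z → (y , j) ∈ z → {T (i <ᵇ j)} → x < y
  smaller {x} {i} {y} {j} x∈ y∈ {t′} = <ᵇ⇒< x y (subst T (sym (orderIso-sound (a ∷ b ∷ d ∷ e ∷ c ∷ []) q12453 t x∈ y∈)) t′)

T-not⇒¬T : ∀ {b} → T (not b) → ¬ T b
T-not⇒¬T {false} _ ()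

¬T⇒T-not : ∀ {b} → ¬ T b → T (not b)
¬T⇒T-not {false} _ = tt
¬T⇒T-not {true}  n = n tt

avoids⇒¬Has12453 : ∀ w → T (avoids w q12453) → ¬ Has12453 w
avoids⇒¬Has12453 w av (a , b , d , e , c , s , ab , bc , cd , de) =
  T-not⇒¬T av (any⁺ _ (lose (∈-subseqs⁺ s) (orderIso-12453⁺ ab bc cd de)))

¬Has12453⇒avoids : ∀ w → ¬ Has12453 w → T (avoids w q12453)
¬Has12453⇒avoids w n = ¬T⇒T-not λ t → case (find (any⁻ _ (subseqs 5 w) t))
  where
  case : (∃ λ s → s ∈ subseqs 5 w × T (orderIso s q12453)) → ⊥
  case (s , s∈ , iso) with ∈-subseqs⁻ 5 w s∈
  case (a ∷ b ∷ d ∷ e ∷ c ∷ [] , _ , iso) | s⊆ , refl = n (a , b , d , e , c , s⊆ , orderIso-12453⁻ iso)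

Within : ℕ → Word → Set
Within n = All (λ x → 1 ≤ x × x ≤ n)

∈-words⁺ : ∀ k w → Within k w → w ∈ words k (length w)
∈-words⁺ k []            []                   = here refl
∈-words⁺ k (suc x ∷ w) ((_ , x<k) ∷ ws) =
  ∈-concatMap⁺ _ (lose (∈-words⁺ k w ws) (∈-map⁺ (λ a → suc a ∷ w) (∈-upTo⁺ x<k)))

∈-words⁻ : ∀ k m {w} → w ∈ words k m → length w ≡ m × Within k w
∈-words⁻ k zero    (here refl) = refl , []
∈-words⁻ k (suc m) w∈ with find (∈-concatMap⁻ (λ w → map (λ a → suc a ∷ w) (upTo k)) {xs = words k m} w∈)
... | v , v∈ , w∈′ with ∈-map⁻ (λ a → suc a ∷ v) w∈′
... | a , a∈ , refl = let (len , all) = ∈-words⁻ k m v∈ in cong suc len , (s≤s z≤n , ∈-upTo⁻ a∈) ∷ all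

unique-words : ∀ k m → Unique (words k m)
unique-words k zero    = [] ∷ []
unique-words k (suc m) = unique-concatMap (unique-words k m)
  (λ {w} _ → Unique.map⁺ (λ { refl → refl }) (Unique.upTo⁺ k))
  λ {x} {y} _ _ z∈ z∈′ → same x y (∈-map⁻ (λ a → suc a ∷ x) z∈) (∈-map⁻ (λ a → suc a ∷ y) z∈′)
  where
  same : ∀ x y {z} → (∃ λ a → a ∈ upTo k × z ≡ suc a ∷ x) → (∃ λ a → a ∈ upTo k × z ≡ suc a ∷ y) → x ≡ y
  same x y (_ , _ , refl) (_ , _ , refl) = refl

distinct⇒unique : ∀ w → T (distinct w) → Unique w
distinct⇒unique []      _ = []
distinct⇒unique (x ∷ w) t with Equivalence.to T-∧ t
... | x∉ , d = ¬Any⇒All¬ w (λ x∈ → T-not⇒¬T x∉ (any⁺ _ (Any.map (λ { {y} refl → ≡⇒≡ᵇ x y refl }) x∈))) ∷ distinct⇒unique w d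

unique⇒distinct : ∀ w → Unique w → T (distinct w)
unique⇒distinct []      _        = tt
unique⇒distinct (x ∷ w) (x∉ ∷ u) = Equivalence.from T-∧
  (¬T⇒T-not (λ t → All¬⇒¬Any x∉ (Any.map (λ {y} → ≡ᵇ⇒≡ x y) (any⁻ _ w t))) , unique⇒distinct w u)

record Avoider (n : ℕ) (w : Word) : Set where
  field
    size   : length w ≡ n
    within : Within n w
    unique : Unique w
    avoid  : ¬ Has12453 w

avoiders : ℕ → List Word
avoiders n = filter (λ p → T? (avoids p q12453)) (perms n)

∈-avoiders⁻ : ∀ n {w} → w ∈ avoiders n → Avoider n w
∈-avoiders⁻ n {w} w∈ with ∈-filter⁻ (λ p → T? (avoids p q12453)) {xs = perms n} w∈
... | w∈p , av with ∈-filter⁻ (λ p → T? (distinct p)) {xs = words n n} w∈p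
... | w∈w , d with ∈-words⁻ n n w∈w
... | len , all = record { size = len ; within = all ; unique = distinct⇒unique w d ; avoid = avoids⇒¬Has12453 w av }

∈-avoiders⁺ : ∀ n {w} → Avoider n w → w ∈ avoiders n
∈-avoiders⁺ n {w} a = ∈-filter⁺ (λ p → T? (avoids p q12453))
  (∈-filter⁺ (λ p → T? (distinct p)) (subst (λ m → w ∈ words n m) size (∈-words⁺ n w within)) (unique⇒distinct w unique))
  (¬Has12453⇒avoids w avoid)
  where open Avoider a

S-≤ : ∀ n ws → (∀ {w} → Avoider n w → w ∈ ws) → S n q12453 ≤ length ws
S-≤ n ws cover = unique-⊆-length
  (Unique.filter⁺ (λ p → T? (avoids p q12453)) (Unique.filter⁺ (λ p → T? (distinct p)) (unique-words n n)))
  (λ w∈ → cover (∈-avoiders⁻ n w∈))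

S-≥ : ∀ n ws → Unique ws → (∀ {w} → w ∈ ws → Avoider n w) → length ws ≤ S n q12453
S-≥ n ws u good = unique-⊆-length u (λ w∈ → ∈-avoiders⁺ n (good w∈))

-- The upper bound

module _ {A : Set} where

  ∑ : (A → ℕ) → List A → ℕ
  ∑ f []       = 0
  ∑ f (x ∷ xs) = f x + ∑ f xs

  ∑-mono : ∀ {f g} xs → (∀ {x} → x ∈ xs → f x ≤ g x) → ∑ f xs ≤ ∑ g xs
  ∑-mono []       le = z≤n
  ∑-mono (x ∷ xs) le = +-mono-≤ (le (here refl)) (∑-mono xs (le ∘ there))

  ∑-*ˡ : ∀ c f xs → ∑ (λ x → c * f x) xs ≡ c * ∑ f xs
  ∑-*ˡ c f []       = sym (*-zeroʳ c)
  ∑-*ˡ c f (x ∷ xs) = trans (cong (c * f x +_) (∑-*ˡ c f xs)) (sym (*-distribˡ-+ c (f x) (∑ f xs)))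

  ∑-++ : ∀ f xs ys → ∑ f (xs ++ ys) ≡ ∑ f xs + ∑ f ys
  ∑-++ f []       ys = refl
  ∑-++ f (x ∷ xs) ys = trans (cong (f x +_) (∑-++ f xs ys)) (sym (+-assoc (f x) (∑ f xs) (∑ f ys)))

∑-map : ∀ {A B : Set} (g : A → B) f xs → ∑ f (map g xs) ≡ ∑ (f ∘ g) xs
∑-map g f []       = refl
∑-map g f (x ∷ xs) = cong (f (g x) +_) (∑-map g f xs)

length-concatMap : ∀ {A B : Set} (g : A → List B) xs → length (concatMap g xs) ≡ ∑ (length ∘ g) xs
length-concatMap g []       = refl
length-concatMap g (x ∷ xs) = trans (length-++ (g x)) (cong (length (g x) +_) (length-concatMap g xs))

-- Removing and restoring the left-to-right minima.

Mask : Set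
Mask = List Bool

masks : ℕ → List Mask
masks zero    = [ [] ]
masks (suc n) = map (true ∷_) (masks n) ++ map (false ∷_) (masks n)

∈-masks⁺ : ∀ u → u ∈ masks (length u)
∈-masks⁺ []          = here refl
∈-masks⁺ (true ∷ u)  = ∈-++⁺ˡ (∈-map⁺ (true ∷_) (∈-masks⁺ u))
∈-masks⁺ (false ∷ u) = ∈-++⁺ʳ (map (true ∷_) (masks (length u))) (∈-map⁺ (false ∷_) (∈-masks⁺ u))

∈-masks⁻ : ∀ n {u} → u ∈ masks n → length u ≡ n
∈-masks⁻ zero    (here refl) = refl
∈-masks⁻ (suc n) u∈ with ∈-++⁻ (map (true ∷_) (masks n)) u∈
... | inj₁ p with ∈-map⁻ (true ∷_) p
...   | _ , v∈ , refl = cong suc (∈-masks⁻ n v∈)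
∈-masks⁻ (suc n) u∈ | inj₂ p with ∈-map⁻ (false ∷_) p
...   | _ , v∈ , refl = cong suc (∈-masks⁻ n v∈)

ones : Mask → ℕ
ones []          = 0
ones (true ∷ u)  = suc (ones u)
ones (false ∷ u) = ones u

kept dropped : Mask → Word → Word
kept []          w       = []
kept (b ∷ u)     []      = []
kept (true ∷ u)  (x ∷ w) = x ∷ kept u w
kept (false ∷ u) (x ∷ w) = kept u w
dropped []          w       = []
dropped (b ∷ u)     []      = []
dropped (true ∷ u)  (x ∷ w) = dropped u w
dropped (false ∷ u) (x ∷ w) = x ∷ dropped u w

weave : Mask → Word → Word → Word
weave []          p       d       = []
weave (true ∷ u)  []      d       = []
weave (true ∷ u)  (x ∷ p) d       = x ∷ weave u p d
weave (false ∷ u) p       []      = []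
weave (false ∷ u) p       (x ∷ d) = x ∷ weave u p d

-- d lists the left-to-right minima of w below m, and p the other letters.
record Minima (m : ℕ) (w : Word) : Set where
  field
    u          : Mask
    p d        : Word
    size       : length u ≡ length w
    woven      : weave u p d ≡ w
    ones-u     : ones u ≡ length p
    sizes      : length w ≡ length p + length d
    descending : Descending d
    d<m        : All (_< m) d
    p⊆w        : p ⊆ w
    d⊆w        : d ⊆ w
    cover      : ∀ {x} → x ∈ w → x ∈ p ⊎ x ∈ d
    lower      : ∀ {a s} → a ∷ s ⊆ p → m ≤ a ⊎ (∃ λ x → x < a × x ∷ a ∷ s ⊆ w)

-- `m` is the minimum of the letters already read; a call with `suc n` on a word over 1, ..., n says
-- that none has been read. The field `lower` speaks of subwords, so that a 1342 among the other
-- letters extends at once to a 12453.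
minima : ∀ m w → Unique w → Minima m w
minima m [] _ = record
  { u = [] ; p = [] ; d = [] ; size = refl ; woven = refl ; ones-u = refl ; sizes = refl ; descending = []
  ; d<m = [] ; p⊆w = [] ; d⊆w = [] ; cover = λ () ; lower = λ () }
minima m (y ∷ w) uq@(_ ∷ uw) with y <? m
... | yes y<m = record
  { u = false ∷ M.u ; p = M.p ; d = y ∷ M.d ; size = cong suc M.size ; woven = cong (y ∷_) M.woven ; ones-u = M.ones-u
  ; sizes = trans (cong suc M.sizes) (sym (+-suc (length M.p) (length M.d)))
  ; descending = M.d<m ∷ M.descending ; d<m = y<m ∷ All.map (λ z<y → <-trans z<y y<m) M.d<m
  ; p⊆w = y ∷ʳ M.p⊆w ; d⊆w = refl ∷ M.d⊆w ; cover = cover ; lower = lower }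
  where
  module M = Minima (minima y w uw)
  cover : ∀ {x} → x ∈ y ∷ w → x ∈ M.p ⊎ x ∈ y ∷ M.d
  cover (here e) = inj₂ (here e)
  cover (there x∈) with M.cover x∈
  ... | inj₁ p = inj₁ p
  ... | inj₂ q = inj₂ (there q)
  lower : ∀ {a s} → a ∷ s ⊆ M.p → m ≤ a ⊎ (∃ λ x → x < a × x ∷ a ∷ s ⊆ y ∷ w)
  lower s⊆ with M.lower s⊆
  ... | inj₂ (x , x<a , s⊆w) = inj₂ (x , x<a , y ∷ʳ s⊆w)
  ... | inj₁ y≤a = inj₂ (y , ≤∧≢⇒< y≤a (λ { refl → Unique[x∷xs]⇒x∉xs uq (to∈ (⊆-trans s⊆ M.p⊆w)) }) , refl ∷ ⊆-trans s⊆ M.p⊆w)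
... | no y≮m = record
  { u = true ∷ M.u ; p = y ∷ M.p ; d = M.d ; size = cong suc M.size ; woven = cong (y ∷_) M.woven ; ones-u = cong suc M.ones-u
  ; sizes = cong suc M.sizes ; descending = M.descending ; d<m = M.d<m
  ; p⊆w = refl ∷ M.p⊆w ; d⊆w = y ∷ʳ M.d⊆w ; cover = cover ; lower = lower }
  where
  module M = Minima (minima m w uw)
  cover : ∀ {x} → x ∈ y ∷ w → x ∈ y ∷ M.p ⊎ x ∈ M.d
  cover (here e) = inj₁ (here e)
  cover (there x∈) with M.cover x∈
  ... | inj₁ p = inj₁ (there p)
  ... | inj₂ q = inj₂ q
  lower : ∀ {a s} → a ∷ s ⊆ y ∷ M.p → m ≤ a ⊎ (∃ λ x → x < a × x ∷ a ∷ s ⊆ y ∷ w)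
  lower (refl ∷ s⊆) = inj₁ (≮⇒≥ y≮m)
  lower (.y ∷ʳ s⊆) with M.lower s⊆
  ... | inj₁ m≤a              = inj₁ m≤a
  ... | inj₂ (x , x<a , s⊆w) = inj₂ (x , x<a , y ∷ʳ s⊆w)

down : ℕ → Word
down zero    = []
down (suc n) = suc n ∷ down n

length-down : ∀ n → length (down n) ≡ n
length-down zero    = refl
length-down (suc n) = cong suc (length-down n)

∈-down⁺ : ∀ n {x} → 1 ≤ x → x ≤ n → x ∈ down n
∈-down⁺ zero    1≤x x≤n = ⊥-elim (<⇒≱ 1≤x x≤n)
∈-down⁺ (suc n) {x} 1≤x x≤n with x ≟ suc n
... | yes e = here e
... | no ne = there (∈-down⁺ n 1≤x (≤-pred (≤∧≢⇒< x≤n ne)))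

-- v drops from n, …, 1 the letters of d.
record Values (n : ℕ) (d : Word) : Set where
  field
    v          : Mask
    size       : length v ≡ n
    dropped-v  : dropped v (down n) ≡ d
    sizes      : ones v + length d ≡ n
    descending : Descending (kept v (down n))
    within     : Within n (kept v (down n))
    fresh      : ∀ {x} → x ∈ kept v (down n) → x ∉ d

values : ∀ n d → Descending d → Within n d → Values n d
values zero [] _ _ = record { v = [] ; size = refl ; dropped-v = refl ; sizes = refl ; descending = [] ; within = [] ; fresh = λ () }
values zero (x ∷ d) _ ((1≤x , x≤0) ∷ _) = ⊥-elim (<⇒≱ 1≤x x≤0)
values (suc n) d desc wi with suc n ∈? d
values (suc n) (x ∷ d) (x> ∷ desc) ((_ , x≤) ∷ wi) | yes (there n∈) = ⊥-elim (<⇒≱ (All.lookup x> n∈) x≤)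
values (suc n) (x ∷ d) (x> ∷ desc) (_ ∷ wi) | yes (here refl) = record
  { v = false ∷ V.v ; size = cong suc V.size ; dropped-v = cong (suc n ∷_) V.dropped-v
  ; sizes = trans (+-suc (ones V.v) (length d)) (cong suc V.sizes) ; descending = V.descending
  ; within = All.map (λ { (l , u) → l , m≤n⇒m≤1+n u }) V.within
  ; fresh = λ { x∈ (here refl) → 1+n≰n (proj₂ (All.lookup V.within x∈)) ; x∈ (there x∈d) → V.fresh x∈ x∈d } }
  where
  below : Values n d
  below = values n d desc (All.zipWith (λ { (y< , l , _) → l , ≤-pred y< }) (x> , wi))
  module V = Values below
... | no n∉ = record
  { v = true ∷ V.v ; size = cong suc V.size ; dropped-v = V.dropped-v
  ; sizes = cong suc V.sizes ; descending = All.map (λ { (_ , u) → s≤s u }) V.within ∷ V.descending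
  ; within = (s≤s z≤n , ≤-refl) ∷ All.map (λ { (l , u) → l , m≤n⇒m≤1+n u }) V.within
  ; fresh = λ { (here refl) x∈d → n∉ x∈d ; (there x∈) x∈d → V.fresh x∈ x∈d } }
  where
  within : Within n d
  within = All.tabulate (λ {y} y∈ → let (l , u) = All.lookup wi y∈ in l , ≤-pred (≤∧≢⇒< u (λ { refl → n∉ y∈ })))
  module V = Values (values n d desc within)

length-kept : ∀ n v → length v ≡ n → length (kept v (down n)) ≡ ones v
length-kept zero    []          _ = refl
length-kept (suc n) (true ∷ v)  e = cong suc (length-kept n v (suc-injective e))
length-kept (suc n) (false ∷ v) e = length-kept n v (suc-injective e)

-- A missing x would give n + 1 distinct letters among 1, ..., n.
surjective : ∀ n {w} → Avoider n w → ∀ {x} → 1 ≤ x → x ≤ n → x ∈ w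
surjective n {w} av {x} 1≤x x≤n with x ∈? w
... | yes x∈ = x∈
... | no x∉  = ⊥-elim (1+n≰n (subst₂ _≤_ (cong suc size) (length-down n)
    (unique-⊆-length (¬Any⇒All¬ w x∉ ∷ unique) sub)))
  where
  open Avoider av
  sub : ∀ {y} → y ∈ x ∷ w → y ∈ down n
  sub (here refl) = ∈-down⁺ n 1≤x x≤n
  sub (there y∈)  = let (l , u) = All.lookup within y∈ in ∈-down⁺ n l u

-- `false` marks the positions (in `u`) and the values (in `v`) of the minima. Left-to-right minima
-- descend, so the values in the order of `down n` can be woven in without further choice.
cell : ℕ → Mask → Mask → List Word
cell n u v = if ones u ≡ᵇ ones v then map (λ p → weave u p (dropped v (down n))) (gen (kept v (down n)) [] []) else []

candidates : ℕ → List Word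
candidates n = concatMap (λ u → concatMap (cell n u) (masks n)) (masks n)

avoider∈candidates : ∀ n {w} → Avoider n w → w ∈ candidates n
avoider∈candidates n {w} av =
  ∈-concatMap⁺ (λ u → concatMap (cell n u) (masks n)) (lose (subst (λ m → M.u ∈ masks m) (trans M.size size) (∈-masks⁺ M.u))
    (∈-concatMap⁺ (cell n M.u) (lose (subst (λ m → V.v ∈ masks m) V.size (∈-masks⁺ V.v)) in-cell)))
  where
  open Avoider av
  module M = Minima (minima (suc n) w unique)
  d-within : Within n M.d
  d-within = All.tabulate (λ x∈ → All.lookup within (∈-⊆ M.d⊆w x∈))
  module V = Values (values n M.d M.descending d-within)
  c = kept V.v (down n)
  p-avoids : ¬ Has1342 M.p
  p-avoids (a , x , y , b , s , ab , bx , xy) with M.lower s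
  ... | inj₁ n<a             = <⇒≱ n<a (proj₂ (All.lookup within (∈-⊆ M.p⊆w (to∈ s))))
  ... | inj₂ (z , z<a , s′) = avoid (z , a , x , y , b , s′ , z<a , ab , bx , xy)
  ones-eq : ones M.u ≡ ones V.v
  ones-eq = +-cancelʳ-≡ (length M.d) (ones M.u) (ones V.v)
    (trans (cong (_+ length M.d) M.ones-u) (trans (sym M.sizes) (trans size (sym V.sizes))))
  c⊆p : ∀ {x} → x ∈ c → x ∈ M.p
  c⊆p x∈ with All.lookup V.within x∈
  ... | l , u with M.cover (surjective n av l u)
  ...   | inj₁ x∈p = x∈p
  ...   | inj₂ x∈d = ⊥-elim (V.fresh x∈ x∈d)
  p∈gen : M.p ∈ gen c [] []
  p∈gen = gen-complete c [] [] p-avoids (λ { [] _ _ () ; (_ ∷ _) _ _ () }) _ record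
    { descending = V.descending
    ; below      = All.tabulate (λ _ → λ ())
    ; sublist    = minimum M.p
    ; remaining  = All.tabulate c⊆p
    ; count      = trans (sym M.ones-u) (trans ones-eq (trans (sym (length-kept n V.v V.size)) (sym (+-identityʳ _))))
    }
  in-cell : w ∈ cell n M.u V.v
  in-cell with ones M.u ≡ᵇ ones V.v | ≡⇒≡ᵇ (ones M.u) (ones V.v) ones-eq
  ... | true | _ = subst (_∈ map (λ p → weave M.u p (dropped V.v (down n))) (gen c [] []))
                     (trans (cong (weave M.u M.p) V.dropped-v) M.woven) (∈-map⁺ _ p∈gen)

length-cell : ∀ n u v → length v ≡ n → length (cell n u v) ≡ (if ones u ≡ᵇ ones v then Z (ones v) [] else 0)
length-cell n u v len with ones u ≡ᵇ ones v
... | false = refl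
... | true  = trans (length-map _ (gen (kept v (down n)) [] []))
                (trans (length-gen (kept v (down n)) [] []) (cong (λ k → Z k []) (length-kept n v len)))

-- α/β approximates √8 from above.
module Weights (α β : ℕ) {{_ : NonZero β}} (8β²≤α² : 8 * (β * β) ≤ α * α) where

  weight : Mask → ℕ
  weight []          = 1
  weight (true ∷ u)  = α * weight u
  weight (false ∷ u) = β * weight u

  ∑-weight : ∀ n → ∑ weight (masks n) ≡ (α + β) ^ n
  ∑-weight zero    = refl
  ∑-weight (suc n) = begin
    ∑ weight (map (true ∷_) (masks n) ++ map (false ∷_) (masks n))
      ≡⟨ ∑-++ weight (map (true ∷_) (masks n)) (map (false ∷_) (masks n)) ⟩
    ∑ weight (map (true ∷_) (masks n)) + ∑ weight (map (false ∷_) (masks n))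
      ≡⟨ cong₂ _+_ (trans (∑-map (true ∷_) weight (masks n)) (∑-*ˡ α weight (masks n)))
                   (trans (∑-map (false ∷_) weight (masks n)) (∑-*ˡ β weight (masks n))) ⟩
    α * ∑ weight (masks n) + β * ∑ weight (masks n)   ≡⟨ sym (*-distribʳ-+ (∑ weight (masks n)) α β) ⟩
    (α + β) * ∑ weight (masks n)                      ≡⟨ cong ((α + β) *_) (∑-weight n) ⟩
    (α + β) ^ suc n ∎
    where open ≡-Reasoning

  -- The factor `β ^ ones u` avoids the subtraction in the exponent of β in `weight u`.
  weight-closed : ∀ u → β ^ ones u * weight u ≡ α ^ ones u * β ^ length u
  weight-closed []          = refl
  weight-closed (true ∷ u)  = trans (l₁ β α (β ^ ones u) (weight u)) (trans (cong (λ z → β * α * z) (weight-closed u)) (l₂ β α (α ^ ones u) (β ^ length u)))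
    where
    l₁ : ∀ b a x y → b * x * (a * y) ≡ b * a * (x * y)
    l₁ = solve-∀
    l₂ : ∀ b a x y → b * a * (x * y) ≡ a * x * (b * y)
    l₂ = solve-∀
  weight-closed (false ∷ u) = trans (l β (β ^ ones u) (weight u)) (trans (cong (β *_) (weight-closed u)) (sym (l β (α ^ ones u) (β ^ length u))))
    where
    l : ∀ b x y → x * (b * y) ≡ b * (x * y)
    l = solve-∀

  8^k≤ : ∀ k → 8 ^ k * (β ^ k * β ^ k) ≤ α ^ k * α ^ k
  8^k≤ zero    = ≤-refl
  8^k≤ (suc k) = subst₂ _≤_ (l₁ (8 ^ k) β (β ^ k)) (l₂ α (α ^ k)) (*-mono-≤ 8β²≤α² (8^k≤ k))
    where
    l₁ : ∀ e b x → 8 * (b * b) * (e * (x * x)) ≡ 8 * e * (b * x * (b * x))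
    l₁ = solve-∀
    l₂ : ∀ a x → a * a * (x * x) ≡ a * x * (a * x)
    l₂ = solve-∀

  -- Since the masks have equally many ones, 8 ^ ones can be shared between them as a power of √8
  -- each. The bound is a product, so its sum over all pairs of masks factors into the square of
  -- `∑-weight`.
  matched≤ : ∀ u v → ones u ≡ ones v → β ^ length u * β ^ length v * 8 ^ ones v ≤ weight u * weight v
  matched≤ u v eq = *-cancelˡ-≤ (x * x) {{m*n≢0 x x {{m^n≢0 β (ones v)}} {{m^n≢0 β (ones v)}}}} (begin
    x * x * (b * c * 8 ^ ones v)      ≡⟨ l₁ x b c (8 ^ ones v) ⟩
    8 ^ ones v * (x * x) * (b * c)    ≤⟨ *-monoˡ-≤ (b * c) (8^k≤ (ones v)) ⟩
    a * a * (b * c)                   ≡⟨ l₂ a b c ⟩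
    a * b * (a * c)                   ≡⟨ cong₂ _*_ (trans (cong (λ k → α ^ k * b) (sym eq)) (trans (sym (weight-closed u))
                                           (cong (λ k → β ^ k * weight u) eq))) (sym (weight-closed v)) ⟩
    x * weight u * (x * weight v)     ≡⟨ sym (l₂ x (weight u) (weight v)) ⟩
    x * x * (weight u * weight v)     ∎)
    where
    open ≤-Reasoning
    x = β ^ ones v
    a = α ^ ones v
    b = β ^ length u
    c = β ^ length v
    l₁ : ∀ x b c e → x * x * (b * c * e) ≡ e * (x * x) * (b * c)
    l₁ = solve-∀
    l₂ : ∀ a b c → a * a * (b * c) ≡ a * b * (a * c)
    l₂ = solve-∀

  cell≤ : ∀ n u v → length u ≡ n → length v ≡ n → β ^ n * β ^ n * length (cell n u v) ≤ weight u * weight v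
  cell≤ n u v refl lv rewrite length-cell n u v lv with ones u ≡ᵇ ones v | ≡ᵇ⇒≡ (ones u) (ones v)
  ... | false | _ = subst (_≤ weight u * weight v) (sym (*-zeroʳ (β ^ n * β ^ n))) z≤n
  ... | true  | f = ≤-trans (*-monoʳ-≤ (β ^ n * β ^ n) (Z≤8^ (ones v)))
                      (subst (λ m → β ^ n * β ^ m * 8 ^ ones v ≤ weight u * weight v) lv (matched≤ u v (f _)))

  candidates≤ : ∀ n → β ^ n * β ^ n * length (candidates n) ≤ (α + β) ^ n * (α + β) ^ n
  candidates≤ n = begin
    B * length (candidates n)
      ≡⟨ cong (B *_) (length-concatMap (λ u → concatMap (cell n u) (masks n)) (masks n)) ⟩
    B * ∑ (λ u → length (concatMap (cell n u) (masks n))) (masks n)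
      ≡⟨ sym (∑-*ˡ B _ (masks n)) ⟩
    ∑ (λ u → B * length (concatMap (cell n u) (masks n))) (masks n)
      ≤⟨ ∑-mono (masks n) (λ {u} u∈ → row u (∈-masks⁻ n u∈)) ⟩
    ∑ (λ u → (α + β) ^ n * weight u) (masks n)
      ≡⟨ trans (∑-*ˡ ((α + β) ^ n) weight (masks n)) (cong ((α + β) ^ n *_) (∑-weight n)) ⟩
    (α + β) ^ n * (α + β) ^ n ∎
    where
    open ≤-Reasoning
    B = β ^ n * β ^ n
    row : ∀ u → length u ≡ n → B * length (concatMap (cell n u) (masks n)) ≤ (α + β) ^ n * weight u
    row u lu = begin
      B * length (concatMap (cell n u) (masks n))   ≡⟨ cong (B *_) (length-concatMap (cell n u) (masks n)) ⟩
      B * ∑ (λ v → length (cell n u v)) (masks n)   ≡⟨ sym (∑-*ˡ B _ (masks n)) ⟩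
      ∑ (λ v → B * length (cell n u v)) (masks n)   ≤⟨ ∑-mono (masks n) (λ {v} v∈ → cell≤ n u v lu (∈-masks⁻ n v∈)) ⟩
      ∑ (λ v → weight u * weight v) (masks n)       ≡⟨ ∑-*ˡ (weight u) weight (masks n) ⟩
      weight u * ∑ weight (masks n)                 ≡⟨ cong (weight u *_) (∑-weight n) ⟩
      weight u * (α + β) ^ n                        ≡⟨ *-comm (weight u) _ ⟩
      (α + β) ^ n * weight u ∎

  S≤ : ∀ n → β ^ n * β ^ n * S n q12453 ≤ (α + β) ^ n * (α + β) ^ n
  S≤ n = ≤-trans (*-monoʳ-≤ (β ^ n * β ^ n) (S-≤ n (candidates n) (avoider∈candidates n))) (candidates≤ n)

^-distribʳ-* : ∀ m n k → (m * n) ^ k ≡ m ^ k * n ^ k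
^-distribʳ-* m n zero    = refl
^-distribʳ-* m n (suc k) = trans (cong (m * n *_) (^-distribʳ-* m n k)) (l m n (m ^ k) (n ^ k))
  where
  l : ∀ m n x y → m * n * (x * y) ≡ m * x * (n * y)
  l = solve-∀

L≤ : ∀ {α β} {{_ : NonZero β}} → 8 * (β * β) ≤ α * α → ∀ {c} → (α + β) * (α + β) * 100 ≤ c * (β * β) → L≤centi q12453 c
L≤ {α} {β} le {c} lec a b _ lt = 0 , λ n _ → *-cancelˡ-≤ (β² ^ n) {{m^n≢0 β² n {{β²≢0}}}} (begin
  β² ^ n * (S n q12453 * b ^ n)               ≡⟨ trans (cong (_* (S n q12453 * b ^ n)) (^-distribʳ-* β β n)) (sym (*-assoc (β ^ n * β ^ n) (S n q12453) (b ^ n))) ⟩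
  β ^ n * β ^ n * S n q12453 * b ^ n          ≤⟨ *-monoˡ-≤ (b ^ n) (Weights.S≤ α β le n) ⟩
  (α + β) ^ n * (α + β) ^ n * b ^ n           ≡⟨ trans (cong (_* b ^ n) (sym (^-distribʳ-* (α + β) (α + β) n))) (sym (^-distribʳ-* ((α + β) * (α + β)) b n)) ⟩
  ((α + β) * (α + β) * b) ^ n                 ≤⟨ ^-monoˡ-≤ n base ⟩
  (β² * a) ^ n                                ≡⟨ ^-distribʳ-* β² a n ⟩
  β² ^ n * a ^ n                              ∎)
  where
  open ≤-Reasoning
  β² = β * β
  β²≢0 : NonZero β²
  β²≢0 = m*n≢0 β β
  l₁ : ∀ x b h → x * b * h ≡ x * h * b
  l₁ = solve-∀
  l₂ : ∀ c s b → c * s * b ≡ s * (c * b)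
  l₂ = solve-∀
  base : (α + β) * (α + β) * b ≤ β² * a
  base = *-cancelʳ-≤ _ _ 100 (begin
    (α + β) * (α + β) * b * 100     ≡⟨ l₁ ((α + β) * (α + β)) b 100 ⟩
    (α + β) * (α + β) * 100 * b     ≤⟨ *-monoˡ-≤ b lec ⟩
    c * β² * b                      ≡⟨ l₂ c β² b ⟩
    β² * (c * b)                    ≤⟨ *-monoʳ-≤ β² (<⇒≤ lt) ⟩
    β² * (a * 100)                  ≡⟨ sym (*-assoc β² a 100) ⟩
    β² * a * 100                    ∎)

L≤1466 : L≤centi q12453 1466
L≤1466 = L≤ {99} {35} (≤ᵇ⇒≤ _ _ _) {1466} (≤ᵇ⇒≤ _ _ _)

-- The lower bound

insertions : ℕ → Word → List Word
insertions v []      = [ [ v ] ]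
insertions v (x ∷ w) = (v ∷ x ∷ w) ∷ map (x ∷_) (insertions v w)

∈-insertions⁻ : ∀ v w {p} → p ∈ insertions v w → ∃₂ λ ys zs → w ≡ ys ++ zs × p ≡ ys ++ v ∷ zs
∈-insertions⁻ v []      (here refl) = [] , [] , refl , refl
∈-insertions⁻ v (x ∷ w) (here refl) = [] , x ∷ w , refl , refl
∈-insertions⁻ v (x ∷ w) (there p∈) with ∈-map⁻ (x ∷_) p∈
... | q , q∈ , refl with ∈-insertions⁻ v w q∈
... | ys , zs , refl , refl = x ∷ ys , zs , refl , refl

unique-insertions : ∀ v w → v ∉ w → Unique (insertions v w)
unique-insertions v []      _  = [] ∷ []
unique-insertions v (x ∷ w) v∉ = ¬Any⇒All¬ _ front ∷ Unique.map⁺ ∷-injectiveʳ (unique-insertions v w (v∉ ∘ there))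
  where
  front : v ∷ x ∷ w ∉ map (x ∷_) (insertions v w)
  front p∈ with ∈-map⁻ (x ∷_) p∈
  ... | _ , _ , refl = v∉ (here refl)

-- Only the finished word is tested, so `cnt` is an exact sum over insertions and each lower bound
-- may select the insertions it likes.
grow : ℕ → Word → List Word
grow zero    w = if avoids w q12453 then [ w ] else []
grow (suc k) w = concatMap (grow k) (insertions (suc k) w)

cnt : ℕ → Word → ℕ
cnt k w = length (grow k w)

cnt-suc : ∀ k w → cnt (suc k) w ≡ ∑ (cnt k) (insertions (suc k) w)
cnt-suc k w = length-concatMap (grow k) (insertions (suc k) w)

∈-grow-suc : ∀ k w {p} → p ∈ grow (suc k) w → ∃₂ λ ys zs → w ≡ ys ++ zs × p ∈ grow k (ys ++ suc k ∷ zs)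
∈-grow-suc k w p∈ with find (∈-concatMap⁻ (grow k) {xs = insertions (suc k) w} p∈)
... | q , q∈ , p∈′ with ∈-insertions⁻ (suc k) w q∈
... | ys , zs , eq , refl = ys , zs , eq , p∈′

∈-grow-zero : ∀ w {p} → p ∈ grow 0 w → p ≡ w × T (avoids w q12453)
∈-grow-zero w p∈ with avoids w q12453
∈-grow-zero w (here refl) | true = refl , _

≺-insert : ∀ {k} ys {zs} → suc k ≺ ys ++ zs → k ≺ ys ++ suc k ∷ zs
≺-insert ys big x∈ with ∈-insert⁻ ys x∈
... | inj₁ refl = ≤-refl
... | inj₂ x∈′  = <-trans ≤-refl (big x∈′)

unique-insert : ∀ {v : ℕ} ys {zs} → v ∉ ys ++ zs → Unique (ys ++ zs) → Unique (ys ++ v ∷ zs)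
unique-insert []       v∉ u        = ¬Any⇒All¬ _ v∉ ∷ u
unique-insert (y ∷ ys) v∉ (y∉ ∷ u) =
  All.++⁺ (All.++⁻ˡ ys y∉) ((λ e → v∉ (here (sym e))) ∷ All.++⁻ʳ ys y∉) ∷ unique-insert ys (v∉ ∘ there) u

grow-avoider : ∀ k w {n p} → k + length w ≡ n → Unique w → k ≺ w → Within n w → p ∈ grow k w → Avoider n p
grow-avoider zero    w refl u big wi p∈ with ∈-grow-zero w p∈
... | refl , av = record { size = refl ; within = wi ; unique = u ; avoid = avoids⇒¬Has12453 w av }
grow-avoider (suc k) w {n} eq u big wi p∈ with ∈-grow-suc k w p∈
... | ys , zs , refl , p∈′ = grow-avoider k (ys ++ suc k ∷ zs)
  (trans (cong (k +_) (trans (length-++ ys) (trans (+-suc (length ys) (length zs)) (cong suc (sym (length-++ ys)))))) (trans (+-suc k _) eq))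
  (unique-insert ys (λ i → <-irrefl refl (big i)) u) (≺-insert ys big)
  (All.++⁺ (All.++⁻ˡ ys wi) ((s≤s z≤n , m+n≤o⇒m≤o (suc k) (≤-reflexive eq)) ∷ All.++⁻ʳ ys wi)) p∈′

filter-filter : ∀ k p → filter (suc k <?_) (filter (k <?_) p) ≡ filter (suc k <?_) p
filter-filter k [] = refl
filter-filter k (x ∷ p) = go (k <? x) (suc k <? x)
  where
  go : Dec (k < x) → Dec (suc k < x) → filter (suc k <?_) (filter (k <?_) (x ∷ p)) ≡ filter (suc k <?_) (x ∷ p)
  go (no k≮x) _ = trans (cong (filter (suc k <?_)) (filter-reject (k <?_) k≮x))
    (trans (filter-filter k p) (sym (filter-reject (suc k <?_) (λ lt → k≮x (<-trans ≤-refl lt)))))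
  go (yes k<x) (yes lt) = trans (cong (filter (suc k <?_)) (filter-accept (k <?_) k<x))
    (trans (filter-accept (suc k <?_) lt) (trans (cong (x ∷_) (filter-filter k p)) (sym (filter-accept (suc k <?_) lt))))
  go (yes k<x) (no ≮) = trans (cong (filter (suc k <?_)) (filter-accept (k <?_) k<x))
    (trans (filter-reject (suc k <?_) ≮) (trans (filter-filter k p) (sym (filter-reject (suc k <?_) ≮))))

-- The letters above k are untouched by the remaining insertions. Thus different words have disjoint
-- sets of completions, as `unique-grow` requires.
filter-grow : ∀ k w {p} → k ≺ w → p ∈ grow k w → filter (k <?_) p ≡ w
filter-grow zero    w big p∈ with ∈-grow-zero w p∈
... | refl , _ = filter-all (0 <?_) (All.tabulate big)
filter-grow (suc k) w {p} big p∈ with ∈-grow-suc k w p∈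
... | ys , zs , refl , p∈′ = begin
  filter (suc k <?_) p                       ≡⟨ sym (filter-filter k p) ⟩
  filter (suc k <?_) (filter (k <?_) p)      ≡⟨ cong (filter (suc k <?_)) (filter-grow k (ys ++ suc k ∷ zs) (≺-insert ys big) p∈′) ⟩
  filter (suc k <?_) (ys ++ suc k ∷ zs)      ≡⟨ filter-++ (suc k <?_) ys (suc k ∷ zs) ⟩
  filter (suc k <?_) ys ++ filter (suc k <?_) (suc k ∷ zs)
    ≡⟨ cong₂ _++_ (filter-all (suc k <?_) (All.tabulate (big ∘ ∈-++⁺ˡ)))
         (trans (filter-reject (suc k <?_) {x = suc k} {xs = zs} (<-irrefl refl)) (filter-all (suc k <?_) (All.tabulate (big ∘ ∈-++⁺ʳ ys)))) ⟩
  ys ++ zs ∎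
  where open ≡-Reasoning

unique-grow : ∀ k w → k ≺ w → Unique (grow k w)
unique-grow zero    w _ with avoids w q12453
... | true  = [] ∷ []
... | false = []
unique-grow (suc k) w big = unique-concatMap (unique-insertions (suc k) w (λ i → <-irrefl refl (big i)))
  (λ x∈ → unique-grow k _ (above x∈))
  (λ x∈ y∈ z∈x z∈y → trans (sym (filter-grow k _ (above x∈) z∈x)) (filter-grow k _ (above y∈) z∈y))
  where
  above : ∀ {q} → q ∈ insertions (suc k) w → k ≺ q
  above q∈ with ∈-insertions⁻ (suc k) w q∈
  ... | ys , zs , refl , refl = ≺-insert ys big

cnt≤S : ∀ n → cnt n [] ≤ S n q12453
cnt≤S n = S-≥ n (grow n []) (unique-grow n [] (λ ())) (grow-avoider n [] (+-identityʳ n) [] (λ ()) [])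

∑-insertions-++ : ∀ F v z w → ∑ (F ∘ (z ++_)) (insertions v w) ≤ ∑ F (insertions v (z ++ w))
∑-insertions-++ F v []      w = ≤-refl
∑-insertions-++ F v (x ∷ z) w = ≤-trans (∑-insertions-++ (F ∘ (x ∷_)) v z w)
  (≤-trans (≤-reflexive (sym (∑-map (x ∷_) F (insertions v (z ++ w))))) (m≤n+m _ _))

cnt≥1 : ∀ k w → k ≺ w → ¬ Has12453 w → 1 ≤ cnt k w
cnt≥1 zero    w big n with avoids w q12453 | ¬Has12453⇒avoids w n
... | true | _ = ≤-refl
cnt≥1 (suc k) w big n = begin
  -- A minimum put at the very end has nothing to its right, so it creates no 12453.
  1                                                   ≤⟨ cnt≥1 k (w ++ [ suc k ]) (≺-insert w big′) (av12453-insert w big′ (λ { (_ , _ , _ , _ , () , _) }) (n ∘ subst Has12453 (++-identityʳ w))) ⟩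
  cnt k (w ++ [ suc k ])                              ≡⟨ sym (+-identityʳ _) ⟩
  ∑ (cnt k ∘ (w ++_)) (insertions (suc k) [])         ≤⟨ ∑-insertions-++ (cnt k) (suc k) w [] ⟩
  ∑ (cnt k) (insertions (suc k) (w ++ []))            ≡⟨ cong (λ u → ∑ (cnt k) (insertions (suc k) u)) (++-identityʳ w) ⟩
  ∑ (cnt k) (insertions (suc k) w)                    ≡⟨ sym (cnt-suc k w) ⟩
  cnt (suc k) w ∎
  where
  open ≤-Reasoning
  big′ : suc k ≺ w ++ []
  big′ = subst (suc k ≺_) (sym (++-identityʳ w)) big

-- C(i + a, i), and the number C(i + e - 1, i) of multisets of size i on e elements.
paths multisets : ℕ → ℕ → ℕ
paths zero    a       = 1
paths (suc i) zero    = 1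
paths (suc i) (suc a) = paths i (suc a) + paths (suc i) a
multisets zero    e       = 1
multisets (suc i) zero    = 0
multisets (suc i) (suc e) = multisets i (suc e) + multisets (suc i) e

-- The positions used in `old` are those in front of one of its letters; the gap at its end is left
-- to `new`. Summing over the letter chosen, with the later choices confined to it and the letters
-- behind it, is the recurrence of `multisets`.
∑-insertions-before : ∀ c i G v old new →
  (∀ o₁ x o₂ → old ≡ o₁ ++ x ∷ o₂ → c * multisets i (length (x ∷ o₂)) ≤ G (o₁ ++ v ∷ x ∷ o₂ ++ new)) →
  c * multisets (suc i) (length old) + ∑ (G ∘ (old ++_)) (insertions v new) ≤ ∑ G (insertions v (old ++ new))
∑-insertions-before c i G v []        new h = ≤-reflexive (cong (_+ ∑ G (insertions v new)) (*-zeroʳ c))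
∑-insertions-before c i G v (x ∷ old) new h = begin
  c * (multisets i (suc (length old)) + multisets (suc i) (length old)) + rest
    ≡⟨ trans (cong (_+ rest) (*-distribˡ-+ c _ (multisets (suc i) (length old)))) (+-assoc (c * multisets i (suc (length old))) _ rest) ⟩
  c * multisets i (suc (length old)) + (c * multisets (suc i) (length old) + rest)
    ≤⟨ +-mono-≤ (h [] x old refl) (∑-insertions-before c i (G ∘ (x ∷_)) v old new (λ o₁ y o₂ eq → h (x ∷ o₁) y o₂ (cong (x ∷_) eq))) ⟩
  G (v ∷ x ∷ old ++ new) + ∑ (G ∘ (x ∷_)) (insertions v (old ++ new))
    ≡⟨ cong (G (v ∷ x ∷ old ++ new) +_) (sym (∑-map (x ∷_) G (insertions v (old ++ new)))) ⟩
  ∑ G (insertions v (x ∷ old ++ new)) ∎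
  where
  open ≤-Reasoning
  rest = ∑ (G ∘ ((x ∷ old) ++_)) (insertions v new)

-- The sum over all insertions of v except the one in front.
inner : (Word → ℕ) → ℕ → Word → ℕ
inner G v []      = 0
inner G v (x ∷ w) = ∑ (G ∘ (x ∷_)) (insertions v w)

∑-insertions-inner : ∀ G v w → ∑ G (insertions v w) ≡ G (v ∷ w) + inner G v w
∑-insertions-inner G v []      = refl
∑-insertions-inner G v (x ∷ w) = cong (G (v ∷ x ∷ w) +_) (∑-map (x ∷_) G (insertions v w))

-- A run is split behind one of its letters, so the gap in front of it is left out, and k counts the
-- letters already passed. The gap in front of the whole suffix is the push of a new run.
inner-run : ∀ c f G v k r s C {m} →
  (∀ x w r₂ → r ≡ x ∷ w ++ r₂ → c * f (suc (length w) + suc k ∷ length r₂ ∷ s) ≤ G (x ∷ w ++ v ∷ r₂ ++ C)) →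
  m ≤ inner (G ∘ (r ++_)) v C → c * splitSum f k (length r) s + m ≤ inner G v (r ++ C)
inner-run c f G v k []      s C {m} h le = ≤-trans (≤-reflexive (cong (_+ m) (*-zeroʳ c))) le
inner-run c f G v k (x ∷ r) s C {m} h le = begin
  c * (f (2 + k ∷ length r ∷ s) + splitSum f (suc k) (length r) s) + m
    ≡⟨ trans (cong (_+ m) (*-distribˡ-+ c (f (2 + k ∷ length r ∷ s)) _)) (+-assoc (c * f (2 + k ∷ length r ∷ s)) _ m) ⟩
  c * f (2 + k ∷ length r ∷ s) + (c * splitSum f (suc k) (length r) s + m)
    ≤⟨ +-mono-≤ (h x [] r refl) (inner-run c f (G ∘ (x ∷_)) v (suc k) r s C
         (λ y w r₂ eq → subst (λ j → c * f (suc j ∷ length r₂ ∷ s) ≤ G (x ∷ y ∷ w ++ v ∷ r₂ ++ C)) (sym (+-suc (length w) (suc k)))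
            (h x (y ∷ w) r₂ (cong (x ∷_) eq))) le) ⟩
  G (x ∷ v ∷ r ++ C) + inner (G ∘ (x ∷_)) v (r ++ C)
    ≡⟨ sym (∑-insertions-inner (G ∘ (x ∷_)) v (r ++ C)) ⟩
  inner G v (x ∷ r ++ C) ∎
  where open ≤-Reasoning

inner-pops : ∀ c f G v rs →
  (∀ pre r post x w r₂ → rs ≡ pre ++ r ∷ post → r ≡ x ∷ w ++ r₂ →
    c * f (suc (length w) + 1 ∷ length r₂ ∷ map length post) ≤ G (concat pre ++ x ∷ w ++ v ∷ r₂ ++ concat post)) →
  c * popSum f (map length rs) ≤ inner G v (concat rs)
inner-pops c f G v []       h = ≤-reflexive (*-zeroʳ c)
inner-pops c f G v (r ∷ rs) h = ≤-trans (≤-reflexive (*-distribˡ-+ c (splitSum f 0 (length r) (map length rs)) _))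
  (inner-run c f G v 0 r (map length rs) (concat rs) (λ x w r₂ eq → h [] r rs x w r₂ refl eq)
    (inner-pops c f (G ∘ (r ++_)) v rs (λ pre r′ post x w r₂ eq eq′ →
      subst (λ u → c * f (suc (length w) + 1 ∷ length r₂ ∷ map length post) ≤ G u)
        (++-assoc r (concat pre) (x ∷ w ++ v ∷ r₂ ++ concat post))
        (h (r ∷ pre) r′ post x w r₂ (cong (r ∷_) eq) eq′))))

-- A stage builds a block new to the right of the block old of the previous stage, and inserts
-- letters among those of old; the word z to the left of old is finished.
record Live (k : ℕ) (z old new : Word) : Set where
  field
    above   : k ≺ z ++ old ++ new
    avoid   : ¬ Has12453 (z ++ old ++ new)
    old-av  : ¬ Has1342 old
    new-av  : ¬ Has1342 new
    old>new : ∀ {x} → x ∈ old → ∀ {y} → y ∈ new → y < x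

-- In contrast to `Maximal`, `concat rs` is any suffix avoiding 231: a shorter one offers fewer
-- insertions, which a lower bound can afford.
record Stacked (new : Word) (rs : List Word) : Set where
  field
    y          : Word
    shape      : new ≡ y ++ concat rs
    av231      : ¬ Has231 (concat rs)
    descending : All Descending rs

1342⇒231 : ∀ {w} → Has1342 w → Has231 w
1342⇒231 (a , c , d , b , s , ab , bc , cd) = c , d , b , ⊆-trans (a ∷ʳ ⊆-refl) s , bc , cd

-- Everything up to the inserted minimum is declared finished, so later minima go to its right. To
-- the right of each there is then only a skew sum of a suffix of `old` and `new`, which avoids
-- 1342.
live-old : ∀ {k z new} o₁ x o₂ → Live (suc k) z (o₁ ++ x ∷ o₂) new → Live k (z ++ o₁ ++ [ suc k ]) (x ∷ o₂) new
live-old {k} {z} {new} o₁ x o₂ L = record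
  { above   = subst (k ≺_) (sym eq′) (≺-insert (z ++ o₁) above′)
  ; avoid   = subst (λ u → ¬ Has12453 u) (sym eq′) (av12453-insert (z ++ o₁) above′
                (av1342-skew (x ∷ o₂) (λ x∈ → old>new (∈-++⁺ʳ o₁ x∈)) tail-av new-av) (subst (λ u → ¬ Has12453 u) eq avoid))
  ; old-av  = tail-av
  ; new-av  = new-av
  ; old>new = λ x∈ → old>new (∈-++⁺ʳ o₁ x∈)
  }
  where
  open Live L
  eq : z ++ (o₁ ++ x ∷ o₂) ++ new ≡ (z ++ o₁) ++ x ∷ o₂ ++ new
  eq = trans (cong (z ++_) (++-assoc o₁ (x ∷ o₂) new)) (sym (++-assoc z o₁ _))
  eq′ : (z ++ o₁ ++ [ suc k ]) ++ x ∷ o₂ ++ new ≡ (z ++ o₁) ++ suc k ∷ x ∷ o₂ ++ new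
  eq′ = trans (cong (_++ x ∷ o₂ ++ new) (sym (++-assoc z o₁ [ suc k ]))) (++-assoc (z ++ o₁) [ suc k ] _)
  above′ : suc k ≺ (z ++ o₁) ++ x ∷ o₂ ++ new
  above′ = subst (suc k ≺_) eq above
  tail-av : ¬ Has1342 (x ∷ o₂)
  tail-av = old-av ∘ Has1342-⊆ (++⁺ˡ o₁ ⊆-refl)

-- `zs` ends the whole word, so its avoiding 231 protects `new` from 1342 and, as 1342 contains 231,
-- the word from 12453.
live-new : ∀ {k z old} ys zs → ¬ Has231 zs → Live (suc k) z old (ys ++ zs) → Live k z old (ys ++ suc k ∷ zs)
live-new {k} {z} {old} ys zs nz L = record
  { above   = subst (k ≺_) (eq (suc k ∷ zs)) (≺-insert (z ++ old ++ ys) above′)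
  ; avoid   = subst (λ u → ¬ Has12453 u) (eq (suc k ∷ zs)) (av12453-insert (z ++ old ++ ys) above′ (nz ∘ 1342⇒231)
                (subst (λ u → ¬ Has12453 u) (sym (eq zs)) avoid))
  ; old-av  = old-av
  ; new-av  = av1342-insert ys (λ x∈ → above (∈-++⁺ʳ z (∈-++⁺ʳ old x∈))) nz new-av
  ; old>new = older
  }
  where
  open Live L
  eq : ∀ u → (z ++ old ++ ys) ++ u ≡ z ++ old ++ ys ++ u
  eq u = trans (++-assoc z (old ++ ys) u) (cong (z ++_) (++-assoc old ys u))
  above′ : suc k ≺ (z ++ old ++ ys) ++ zs
  above′ = subst (suc k ≺_) (sym (eq zs)) above
  older : ∀ {x} → x ∈ old → ∀ {y} → y ∈ ys ++ suc k ∷ zs → y < x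
  older x∈ y∈ with ∈-insert⁻ ys y∈
  ... | inj₁ refl = above (∈-++⁺ʳ z (∈-++⁺ˡ x∈))
  ... | inj₂ y∈′  = old>new x∈ y∈′

stacked-push : ∀ {v y} rs → v ≺ concat rs → ¬ Has231 (concat rs) → All Descending rs → Stacked (y ++ v ∷ concat rs) ([ v ] ∷ rs)
stacked-push {v} {y} rs v≺ n ds = record { y = y ; shape = refl ; av231 = av231-insert [] v≺ [] n ; descending = ([] ∷ []) ∷ ds }

descending-++ : ∀ xs {ys v} → Descending (xs ++ ys) → v ≺ xs → Descending (xs ++ [ v ]) × Descending ys
descending-++ []       d        v≺ = [] ∷ [] , d
descending-++ (x ∷ xs) (x> ∷ d) v≺ = let (l , r) = descending-++ xs d (v≺ ∘ there) in
  All.++⁺ (All.++⁻ˡ xs x>) (v≺ (here refl) ∷ []) ∷ l , r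

-- Behind the descending `x ∷ w` a new minimum makes no 231. The runs in `pre` are given up, since
-- an ascent from them could end before `v`.
stacked-pop : ∀ {v y} pre x w r₂ post → v ≺ concat (pre ++ (x ∷ w ++ r₂) ∷ post) →
  ¬ Has231 (concat (pre ++ (x ∷ w ++ r₂) ∷ post)) → All Descending (pre ++ (x ∷ w ++ r₂) ∷ post) →
  Stacked (y ++ concat pre ++ x ∷ w ++ v ∷ r₂ ++ concat post) ((x ∷ w ++ [ v ]) ∷ r₂ ∷ post)
stacked-pop {v} {y} pre x w r₂ post v≺ n ds = record
  { y = y ++ concat pre
  ; shape = trans (sym (++-assoc y (concat pre) _)) (cong ((y ++ concat pre) ++_) (sym eq))
  ; av231 = subst (λ u → ¬ Has231 u) (sym eq) (av231-insert (x ∷ w) (v≺ ∘ ∈-⊆ sub) (dropˡ (proj₁ split)) (n ∘ Has231-⊆ sub))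
  ; descending = proj₁ split ∷ proj₂ split ∷ All.tail (All.++⁻ʳ pre ds)
  }
  where
  eq : (x ∷ w ++ [ v ]) ++ r₂ ++ concat post ≡ x ∷ w ++ v ∷ r₂ ++ concat post
  eq = cong (x ∷_) (++-assoc w [ v ] (r₂ ++ concat post))
  sub : x ∷ w ++ r₂ ++ concat post ⊆ concat (pre ++ (x ∷ w ++ r₂) ∷ post)
  sub = ⊆-trans (⊆-reflexive (cong (x ∷_) (sym (++-assoc w r₂ (concat post)))))
    (subst (_ ⊆_) (concat-++ pre ((x ∷ w ++ r₂) ∷ post)) (++⁺ˡ (concat pre) ⊆-refl))
  split : Descending (x ∷ w ++ [ v ]) × Descending r₂
  split = descending-++ (x ∷ w) (All.head (All.++⁻ʳ pre ds)) (v≺ ∘ ∈-⊆ sub ∘ ∈-++⁺ˡ)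
  dropˡ : ∀ {xs ys} → Descending (xs ++ ys) → Descending xs
  dropˡ {[]}     _        = []
  dropˡ {a ∷ xs} (p ∷ ps) = All.++⁻ˡ xs p ∷ dropˡ {xs} ps

module Stage (K m B : ℕ)
  (end : ∀ z old new → Live K z old new → length new ≡ m → B ≤ cnt K (z ++ old ++ new)) where

  -- With i minima for `old` and a letters for `new` still to come, `paths` counts the ways their
  -- values interleave, `multisets` the positions in `old`, `Z` those in `new`, and `B` bounds what
  -- follows the stage.
  Bound : ℕ → ℕ → Word → List Word → ℕ
  Bound i a old rs = paths i a * multisets i (length old) * Z a (map length rs) * B

  Goal : ℕ → ℕ → ℕ → Set
  Goal i a k = ∀ z old new rs → Live k z old new → Stacked new rs → length new + a ≡ m →
    Bound i a old rs ≤ cnt k (z ++ old ++ new)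

  module _ {k z old new rs} (L : Live (suc k) z old new) (St : Stacked new rs) where

    private
      v = suc k
      G : Word → ℕ
      G u = cnt k (z ++ u)

    insert-in-new : ∀ i a → Goal i a k → length new + suc a ≡ m →
      paths i a * multisets i (length old) * Z (suc a) (map length rs) * B ≤ ∑ (G ∘ (old ++_)) (insertions v new)
    insert-in-new i a goal len with Stacked.y St | Stacked.shape St
    ... | y | refl = begin
      p * Z (suc a) ss * B                                   ≡⟨ l p (Z a (1 ∷ ss)) (popSum (Z a) ss) B ⟩
      p * B * Z a (1 ∷ ss) + p * B * popSum (Z a) ss         ≤⟨ +-mono-≤ push (inner-pops (p * B) (Z a) G′ v rs pop) ⟩
      G′ (v ∷ concat rs) + inner G′ v (concat rs)            ≡⟨ sym (∑-insertions-inner G′ v (concat rs)) ⟩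
      ∑ G′ (insertions v (concat rs))                        ≤⟨ ∑-insertions-++ (G ∘ (old ++_)) v y (concat rs) ⟩
      ∑ (G ∘ (old ++_)) (insertions v (y ++ concat rs))      ∎
      where
      open ≤-Reasoning
      open Stacked St using (av231; descending)
      p = paths i a * multisets i (length old)
      ss = map length rs
      G′ : Word → ℕ
      G′ u = G (old ++ y ++ u)
      l : ∀ p x y b → p * (x + y) * b ≡ p * b * x + p * b * y
      l = solve-∀
      v≺ : v ≺ concat rs
      v≺ x∈ = Live.above L (∈-++⁺ʳ z (∈-++⁺ʳ old (∈-++⁺ʳ y x∈)))
      via : ∀ ys zs rs′ → y ++ concat rs ≡ ys ++ zs → ¬ Has231 zs → Stacked (ys ++ v ∷ zs) rs′ →
        p * B * Z a (map length rs′) ≤ G (old ++ ys ++ v ∷ zs)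
      via ys zs rs′ eq nz St′ = ≤-trans (≤-reflexive (swap p B (Z a (map length rs′))))
        (goal z old (ys ++ v ∷ zs) rs′ (live-new ys zs nz (subst (Live (suc k) z old) eq L)) St′
          (trans (cong (_+ a) (trans (length-++ ys) (trans (+-suc (length ys) (length zs)) (cong suc (trans (sym (length-++ ys)) (cong length (sym eq)))))))
            (trans (sym (+-suc (length (y ++ concat rs)) a)) len)))
        where
        swap : ∀ p b x → p * b * x ≡ p * x * b
        swap = solve-∀
      push : p * B * Z a (1 ∷ ss) ≤ G′ (v ∷ concat rs)
      push = via y (concat rs) ([ v ] ∷ rs) refl av231 (stacked-push rs v≺ av231 descending)
      pop : ∀ pre r post x w r₂ → rs ≡ pre ++ r ∷ post → r ≡ x ∷ w ++ r₂ →
        p * B * Z a (suc (length w) + 1 ∷ length r₂ ∷ map length post) ≤ G′ (concat pre ++ x ∷ w ++ v ∷ r₂ ++ concat post)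
      pop pre _ post x w r₂ refl refl = subst₂ _≤_
        (cong (λ j → p * B * Z a (suc j ∷ length r₂ ∷ map length post)) (length-++ w))
        (cong (λ u → G (old ++ u)) (eq (v ∷ zs)))
        (via (y ++ concat pre ++ x ∷ w) zs ((x ∷ w ++ [ v ]) ∷ r₂ ∷ post)
          (trans (cong (y ++_) (trans (sym (concat-++ pre _)) (cong (λ u → concat pre ++ x ∷ u) (++-assoc w r₂ (concat post))))) (sym (eq zs)))
          (λ h → av231 (Has231-⊆ sub h))
          (subst (λ u → Stacked u ((x ∷ w ++ [ v ]) ∷ r₂ ∷ post)) (sym (eq (v ∷ zs))) (stacked-pop {y = y} pre x w r₂ post v≺ av231 descending)))
        where
        zs = r₂ ++ concat post
        eq : ∀ u → (y ++ concat pre ++ x ∷ w) ++ u ≡ y ++ concat pre ++ x ∷ w ++ u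
        eq u = trans (++-assoc y (concat pre ++ x ∷ w) u) (cong (y ++_) (++-assoc (concat pre) (x ∷ w) u))
        sub : zs ⊆ concat (pre ++ (x ∷ w ++ r₂) ∷ post)
        sub = subst (zs ⊆_) (concat-++ pre ((x ∷ w ++ r₂) ∷ post)) (++⁺ˡ (concat pre)
          (⊆-trans (++⁺ˡ (x ∷ w) ⊆-refl) (⊆-reflexive (sym (++-assoc (x ∷ w) r₂ (concat post))))))

    insert-in-old : ∀ i a {rest} → Goal i a k → length new + a ≡ m → rest ≤ ∑ (G ∘ (old ++_)) (insertions v new) →
      paths i a * Z a (map length rs) * B * multisets (suc i) (length old) + rest ≤ cnt (suc k) (z ++ old ++ new)
    insert-in-old i a {rest} goal len le = begin
      c * multisets (suc i) (length old) + rest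
        ≤⟨ +-monoʳ-≤ (c * multisets (suc i) (length old)) le ⟩
      c * multisets (suc i) (length old) + ∑ (G ∘ (old ++_)) (insertions v new)
        ≤⟨ ∑-insertions-before c i G v old new before ⟩
      ∑ G (insertions v (old ++ new))
        ≤⟨ ∑-insertions-++ (cnt k) v z (old ++ new) ⟩
      ∑ (cnt k) (insertions v (z ++ old ++ new))
        ≡⟨ sym (cnt-suc k (z ++ old ++ new)) ⟩
      cnt (suc k) (z ++ old ++ new) ∎
      where
      open ≤-Reasoning
      c = paths i a * Z a (map length rs) * B
      swap : ∀ p x b e → p * x * b * e ≡ p * e * x * b
      swap = solve-∀
      before : ∀ o₁ x o₂ → old ≡ o₁ ++ x ∷ o₂ → c * multisets i (length (x ∷ o₂)) ≤ G (o₁ ++ v ∷ x ∷ o₂ ++ new)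
      before o₁ x o₂ refl = ≤-trans (≤-reflexive (swap (paths i a) (Z a (map length rs)) B (multisets i (length (x ∷ o₂)))))
        (subst (λ u → Bound i a (x ∷ o₂) rs ≤ cnt k u)
          (trans (++-assoc z (o₁ ++ [ v ]) _) (cong (z ++_) (++-assoc o₁ [ v ] _)))
          (goal (z ++ o₁ ++ [ v ]) (x ∷ o₂) new rs (live-old o₁ x o₂ L) St len))

  -- Pascal's rule for `paths`: the next value goes either into `old` or into `new`, at disjoint
  -- sets of positions.
  stage : ∀ i a k → k ≡ i + a + K → Goal i a k
  stage zero zero k refl z old new rs L St len =
    ≤-trans (≤-reflexive (+-identityʳ B)) (end z old new L (trans (sym (+-identityʳ _)) len))
  stage zero (suc a) (suc k) eq z old new rs L St len = begin
    1 * 1 * Z (suc a) (map length rs) * B               ≤⟨ insert-in-new L St 0 a (stage 0 a k (suc-injective eq)) len ⟩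
    ∑ (λ u → cnt k (z ++ old ++ u)) (insertions (suc k) new)
      ≤⟨ ∑-insertions-++ (λ u → cnt k (z ++ u)) (suc k) old new ⟩
    ∑ (λ u → cnt k (z ++ u)) (insertions (suc k) (old ++ new))
      ≤⟨ ∑-insertions-++ (cnt k) (suc k) z (old ++ new) ⟩
    ∑ (cnt k) (insertions (suc k) (z ++ old ++ new))    ≡⟨ sym (cnt-suc k (z ++ old ++ new)) ⟩
    cnt (suc k) (z ++ old ++ new)                       ∎
    where open ≤-Reasoning
  stage (suc i) zero (suc k) eq z old new rs L St len = ≤-trans
    (≤-reflexive (trans (l (paths-zero i) (multisets (suc i) (length old)) B) (sym (+-identityʳ _))))
    (insert-in-old L St i 0 (stage i 0 k (suc-injective eq)) len z≤n)
    where
    paths-zero : ∀ i → paths i 0 ≡ 1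
    paths-zero zero    = refl
    paths-zero (suc i) = refl
    l : ∀ {p} → p ≡ 1 → ∀ e b → 1 * e * 1 * b ≡ p * 1 * b * e
    l refl = solve-∀
  stage (suc i) (suc a) (suc k) eq z old new rs L St len = ≤-trans
    (≤-reflexive (l (paths i (suc a)) (paths (suc i) a) (multisets (suc i) (length old)) (Z (suc a) (map length rs)) B))
    (insert-in-old L St i (suc a) (stage i (suc a) k (suc-injective eq)) len
      (insert-in-new L St (suc i) a (stage (suc i) a k (trans (suc-injective eq) (cong (_+ K) (+-suc i a)))) len))
    where
    l : ∀ p q e x b → (p + q) * e * x * b ≡ p * x * b * e + q * e * x * b
    l = solve-∀

live-end : ∀ {k z old new} → Live k z old new → Live k (z ++ old) new []
live-end {k} {z} {old} {new} L = record
  { above   = subst (k ≺_) eq above ; avoid = subst (λ u → ¬ Has12453 u) eq avoid ; old-av = new-av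
  ; new-av  = λ { (_ , _ , _ , _ , () , _) } ; old>new = λ _ () }
  where
  open Live L
  eq : z ++ old ++ new ≡ (z ++ old) ++ new ++ []
  eq = trans (sym (++-assoc z old new)) (cong ((z ++ old) ++_) (sym (++-identityʳ new)))

stacked-[] : Stacked [] []
stacked-[] = record { y = [] ; shape = refl ; av231 = λ { (_ , _ , _ , () , _) } ; descending = [] }

blockCount : ℕ → ℕ → ℕ
blockCount d m = paths d m * multisets d m * Z m []

-- Each stage takes the last block as `old` and starts an empty `new`; the r letters left over go to
-- the end by `cnt≥1`.
iterated : ∀ d m r M z old new → Live (M * (d + m) + r) z old new → length new ≡ m →
  blockCount d m ^ M ≤ cnt (M * (d + m) + r) (z ++ old ++ new)
iterated d m r zero    z old new L _ = cnt≥1 r _ (Live.above L) (Live.avoid L)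
iterated d m r (suc M) z old new L len = begin
  blockCount d m * W ^ M               ≡⟨ cong (λ j → paths d m * multisets d j * Z m [] * W ^ M) (sym len) ⟩
  Stage.Bound K m (W ^ M) (iterated d m r M) d m new []
    ≤⟨ Stage.stage K m (W ^ M) (iterated d m r M) d m ((d + m) + M * (d + m) + r) (+-assoc (d + m) (M * (d + m)) r)
         (z ++ old) new [] [] (live-end L) stacked-[] refl ⟩
  cnt (suc M * (d + m) + r) ((z ++ old) ++ new ++ [])
    ≡⟨ cong (cnt (suc M * (d + m) + r)) (trans (cong ((z ++ old) ++_) (++-identityʳ new)) (++-assoc z old new)) ⟩
  cnt (suc M * (d + m) + r) (z ++ old ++ new) ∎
  where
  open ≤-Reasoning
  K = M * (d + m) + r
  W = blockCount d m

Z≥1 : ∀ n s → 1 ≤ Z n s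
Z≥1 zero    s = ≤-refl
Z≥1 (suc n) s = ≤-trans (Z≥1 n (1 ∷ s)) (m≤m+n _ _)

blockCount^≤S : ∀ d m M r → blockCount d m ^ M ≤ S (m + (M * (d + m) + r)) q12453
blockCount^≤S d m M r = begin
  W ^ M                              ≡⟨ sym (*-identityˡ (W ^ M)) ⟩
  1 * W ^ M                          ≤⟨ *-monoˡ-≤ (W ^ M) (≤-trans (Z≥1 m []) (≤-reflexive (sym (*-identityˡ (Z m []))))) ⟩
  -- The first block has no predecessor to receive minima, so its stage has d = 0.
  1 * 1 * Z m [] * W ^ M             ≤⟨ Stage.stage K m (W ^ M) (iterated d m r M) 0 m (m + K) refl [] [] [] []
                                          (record { above = λ () ; avoid = λ { (_ , _ , _ , _ , _ , () , _) }
                                                  ; old-av = λ { (_ , _ , _ , _ , () , _) } ; new-av = λ { (_ , _ , _ , _ , () , _) }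
                                                  ; old>new = λ () }) stacked-[] refl ⟩
  cnt (m + K) []                     ≤⟨ cnt≤S (m + K) ⟩
  S (m + K) q12453                   ∎
  where
  open ≤-Reasoning
  K = M * (d + m) + r
  W = blockCount d m

-- Supermultiplicativity.

splitSum-++ : ∀ {f g t} → (∀ s → f s ≤ g (s ++ t)) → ∀ c b s → splitSum f c b s ≤ splitSum g c b (s ++ t)
splitSum-++ le c zero    s = z≤n
splitSum-++ le c (suc b) s = +-mono-≤ (le _) (splitSum-++ le (suc c) b s)

popSum-++ : ∀ {f g t} → (∀ s → f s ≤ g (s ++ t)) → ∀ s → popSum f s ≤ popSum g (s ++ t)
popSum-++ le []      = z≤n
popSum-++ le (r ∷ s) = +-mono-≤ (splitSum-++ le 0 r s) (popSum-++ le s)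

Z-++ : ∀ n s t → Z n s ≤ Z n (s ++ t)
Z-++ zero    s t = ≤-refl
Z-++ (suc n) s t = +-mono-≤ (Z-++ n (1 ∷ s) t) (popSum-++ (λ s → Z-++ n s t) s)

-- After n insertions the next m can proceed as if the stack reached were empty, because runs
-- further down only add choices.
Z-+ : ∀ n m s → Z m [] * Z n s ≤ Z (n + m) s
Z-+ zero    m s = ≤-trans (≤-reflexive (*-identityʳ (Z m []))) (Z-++ m [] s)
Z-+ (suc n) m s = begin
  Z m [] * (Z n (1 ∷ s) + popSum (Z n) s)             ≡⟨ *-distribˡ-+ (Z m []) (Z n (1 ∷ s)) (popSum (Z n) s) ⟩
  Z m [] * Z n (1 ∷ s) + Z m [] * popSum (Z n) s      ≤⟨ +-monoʳ-≤ (Z m [] * Z n (1 ∷ s)) (m≤m+n _ 0) ⟩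
  Z m [] * Z n (1 ∷ s) + (Z m [] * popSum (Z n) s + 0 * popSum (Z n) s)
    ≡⟨ cong (Z m [] * Z n (1 ∷ s) +_) (sym (popSum-linear (Z m []) 0 (Z n) (Z n) s)) ⟩
  Z m [] * Z n (1 ∷ s) + popSum (λ t → Z m [] * Z n t + 0) s
    ≤⟨ +-mono-≤ (Z-+ n m (1 ∷ s)) (popSum-mono (λ t → ≤-trans (≤-reflexive (+-identityʳ _)) (Z-+ n m t)) s) ⟩
  Z (n + m) (1 ∷ s) + popSum (Z (n + m)) s            ∎
  where open ≤-Reasoning

Z-^ : ∀ n j → Z n [] ^ j ≤ Z (j * n) []
Z-^ n zero    = ≤-refl
Z-^ n (suc j) = begin
  Z n [] * Z n [] ^ j        ≤⟨ *-monoʳ-≤ (Z n []) (Z-^ n j) ⟩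
  Z n [] * Z (j * n) []      ≡⟨ *-comm (Z n []) _ ⟩
  Z (j * n) [] * Z n []      ≤⟨ Z-+ n (j * n) [] ⟩
  Z (n + j * n) []           ∎
  where open ≤-Reasoning

paths-mono : ∀ i a b → paths i b ≤ paths i (a + b)
paths-mono i zero    b = ≤-refl
paths-mono i (suc a) b = ≤-trans (paths-mono i a b) (grow-a i (a + b))
  where
  grow-a : ∀ i a → paths i a ≤ paths i (suc a)
  grow-a zero    a       = ≤-refl
  grow-a (suc i) zero    = m≤n+m 1 _
  grow-a (suc i) (suc a) = m≤n+m (paths (suc i) (suc a)) (paths i (2 + a))

paths-monoˡ : ∀ j i a → paths i a ≤ paths (j + i) a
paths-monoˡ zero    i a       = ≤-refl
paths-monoˡ (suc j) i a = ≤-trans (paths-monoˡ j i a) (grow-i (j + i) a)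
  where
  grow-i : ∀ i a → paths i a ≤ paths (suc i) a
  grow-i zero    zero    = ≤-refl
  grow-i (suc i) zero    = ≤-refl
  grow-i i       (suc a) = m≤m+n _ _

-- Counts the lattice paths through a prescribed point.
paths-* : ∀ i a j b → paths i a * paths j b ≤ paths (i + j) (a + b)
paths-* zero    a       j b = ≤-trans (≤-reflexive (+-identityʳ _)) (paths-mono j a b)
paths-* (suc i) zero    j b = ≤-trans (≤-reflexive (+-identityʳ _)) (paths-monoˡ (suc i) j b)
paths-* (suc i) (suc a) j b = ≤-trans (≤-reflexive (*-distribʳ-+ (paths j b) (paths i (suc a)) (paths (suc i) a)))
  (+-mono-≤ (paths-* i (suc a) j b) (paths-* (suc i) a j b))

multisets-mono : ∀ i a b → multisets i b ≤ multisets i (a + b)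
multisets-mono i       zero    b = ≤-refl
multisets-mono zero    (suc a) b = ≤-refl
multisets-mono (suc i) (suc a) b = ≤-trans (multisets-mono (suc i) a b) (m≤n+m _ _)

multisets-* : ∀ i a j b → multisets i a * multisets j b ≤ multisets (i + j) (a + b)
multisets-* zero    a       j b = ≤-trans (≤-reflexive (+-identityʳ _)) (multisets-mono j a b)
multisets-* (suc i) zero    j b = z≤n
multisets-* (suc i) (suc a) j b = ≤-trans (≤-reflexive (*-distribʳ-+ (multisets j b) (multisets i (suc a)) (multisets (suc i) a)))
  (+-mono-≤ (multisets-* i (suc a) j b) (multisets-* (suc i) a j b))

^-supermultiplicative : ∀ (f : ℕ → ℕ → ℕ) → 1 ≤ f 0 0 → (∀ i a j b → f i a * f j b ≤ f (i + j) (a + b)) →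
  ∀ i a n → f i a ^ n ≤ f (n * i) (n * a)
^-supermultiplicative f base mult i a zero    = base
^-supermultiplicative f base mult i a (suc n) = ≤-trans
  (*-monoʳ-≤ (f i a) (^-supermultiplicative f base mult i a n)) (mult i a (n * i) (n * a))

-- The length `suc n` at which `Z` reaches (u/v) ^ suc n comes from a pigeonhole and has no usable
-- numerical value. So the numerical inequality is checked for a small block (d, m), which is then
-- scaled by `suc n`; all three factors are supermultiplicative.
blockCount-growth : ∀ {u v n} {{_ : NonZero v}} → u ^ suc n ≤ v ^ suc n * Z (suc n) [] → ∀ {x y d m} →
  v ^ m * x ^ (d + m) ≤ paths d m * multisets d m * u ^ m * y ^ (d + m) →
  x ^ (suc n * d + suc n * m) ≤ blockCount (suc n * d) (suc n * m) * y ^ (suc n * d + suc n * m)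
blockCount-growth {u} {v} {n} hZ {x} {y} {d} {m} h = *-cancelˡ-≤ (v ^ (s * m)) {{m^n≢0 v (s * m)}} (begin
  v ^ (s * m) * x ^ (s * d + s * m)
    ≡⟨ cong₂ _*_ (pow v m) (trans (cong (x ^_) (sym (*-distribˡ-+ s d m))) (pow x (d + m))) ⟩
  (v ^ m) ^ s * (x ^ (d + m)) ^ s
    ≡⟨ sym (^-distribʳ-* (v ^ m) (x ^ (d + m)) s) ⟩
  (v ^ m * x ^ (d + m)) ^ s
    ≤⟨ ^-monoˡ-≤ s h ⟩
  (p * e * u ^ m * y ^ (d + m)) ^ s
    ≡⟨ trans (^-distribʳ-* (p * e * u ^ m) (y ^ (d + m)) s) (cong (_* (y ^ (d + m)) ^ s)
         (trans (^-distribʳ-* (p * e) (u ^ m) s) (cong (_* (u ^ m) ^ s) (^-distribʳ-* p e s)))) ⟩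
  p ^ s * e ^ s * (u ^ m) ^ s * (y ^ (d + m)) ^ s
    ≤⟨ *-monoˡ-≤ ((y ^ (d + m)) ^ s) (*-mono-≤
         (*-mono-≤ (^-supermultiplicative paths ≤-refl paths-* d m s) (^-supermultiplicative multisets ≤-refl multisets-* d m s))
         (≤-trans (≤-reflexive (swap u m)) (≤-trans (^-monoˡ-≤ m hZ) (≤-reflexive (^-distribʳ-* (v ^ s) (Z s []) m))))) ⟩
  paths (s * d) (s * m) * multisets (s * d) (s * m) * ((v ^ s) ^ m * Z s [] ^ m) * (y ^ (d + m)) ^ s
    ≤⟨ *-monoˡ-≤ ((y ^ (d + m)) ^ s) (*-monoʳ-≤ P (*-monoʳ-≤ ((v ^ s) ^ m) (≤-trans (Z-^ s m) (≤-reflexive (cong (λ k → Z k []) (*-comm m s)))))) ⟩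
  P * ((v ^ s) ^ m * Z (s * m) []) * (y ^ (d + m)) ^ s
    ≡⟨ cong₂ (λ a b → P * (a * Z (s * m) []) * b) (^-*-assoc v s m) (trans (sym (pow y (d + m))) (cong (y ^_) (*-distribˡ-+ s d m))) ⟩
  P * (v ^ (s * m) * Z (s * m) []) * y ^ (s * d + s * m)
    ≡⟨ l P (v ^ (s * m)) (Z (s * m) []) (y ^ (s * d + s * m)) ⟩
  v ^ (s * m) * (blockCount (s * d) (s * m) * y ^ (s * d + s * m)) ∎)
  where
  open ≤-Reasoning
  s = suc n
  p = paths d m
  e = multisets d m
  P = paths (s * d) (s * m) * multisets (s * d) (s * m)
  pow : ∀ z k → z ^ (s * k) ≡ (z ^ k) ^ s
  pow z k = trans (cong (z ^_) (*-comm s k)) (sym (^-*-assoc z k s))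
  swap : ∀ z k → (z ^ k) ^ s ≡ (z ^ s) ^ k
  swap z k = trans (sym (pow z k)) (sym (^-*-assoc z s k))
  l : ∀ p a z b → p * (a * z) * b ≡ a * (p * z * b)
  l = solve-∀

-- From block counts to the growth rate.

bernoulli : ∀ c k → c ^ k * (c + k) ≤ suc c ^ k * c
bernoulli c zero    = ≤-reflexive (cong (1 *_) (+-identityʳ c))
bernoulli c (suc k) = begin
  c * c ^ k * (c + suc k)                 ≤⟨ m≤m+n _ (c ^ k * k) ⟩
  c * c ^ k * (c + suc k) + c ^ k * k     ≡⟨ l c (c ^ k) k ⟩
  suc c * (c ^ k * (c + k))               ≤⟨ *-monoʳ-≤ (suc c) (bernoulli c k) ⟩
  suc c * (suc c ^ k * c)                 ≡⟨ sym (*-assoc (suc c) (suc c ^ k) c) ⟩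
  suc c * suc c ^ k * c                   ∎
  where
  open ≤-Reasoning
  l : ∀ c x k → c * x * (c + suc k) + x * k ≡ suc c * (x * (c + k))
  l = solve-∀

outgrows : ∀ C c k → C * c < k → C * c ^ k ≤ suc c ^ k
outgrows C zero    (suc k) _  = ≤-trans (≤-reflexive (*-zeroʳ C)) z≤n
outgrows C (suc c) k       lt = *-cancelʳ-≤ _ _ (suc c) (begin
  C * suc c ^ k * suc c          ≡⟨ l C (suc c ^ k) (suc c) ⟩
  suc c ^ k * (C * suc c)        ≤⟨ *-monoʳ-≤ (suc c ^ k) (≤-trans (<⇒≤ lt) (m≤n+m k (suc c))) ⟩
  suc c ^ k * (suc c + k)        ≤⟨ bernoulli (suc c) k ⟩
  suc (suc c) ^ k * suc c        ∎)
  where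
  open ≤-Reasoning
  l : ∀ C x c → C * x * c ≡ x * (C * c)
  l = solve-∀

-- The strict inequality e < c * b leaves room for the base e + 1. Its exponential gain over e
-- absorbs the bounded loss from the first block and from the remainder of n modulo d + m.
L≥ : ∀ c d m {{_ : NonZero (d + m)}} → c ^ (d + m) ≤ blockCount d m * 100 ^ (d + m) → L≥centi q12453 c
L≥ c d m hW a b 0<b lt = N , bound
  where
  ℓ = d + m
  W = blockCount d m
  e = a * 100
  C = suc e ^ (m + ℓ)
  -- Guarantees more than C * e full blocks, as `outgrows` demands; `C` bounds the power of e lost
  -- outside these blocks.
  N = m + suc (C * e) * ℓ
  instance
    b≢0 : NonZero b
    b≢0 = >-nonZero 0<b
  bound : ∀ n → N ≤ n → a ^ n ≤ S n q12453 * b ^ n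
  bound n N≤n = *-cancelʳ-≤ _ _ (100 ^ n) {{m^n≢0 100 n}} (begin
    a ^ n * 100 ^ n                               ≡⟨ sym (^-distribʳ-* a 100 n) ⟩
    e ^ n                                         ≡⟨ cong (e ^_) n≡ ⟩
    e ^ (m + (M * ℓ + r))                         ≡⟨ trans (cong (e ^_) (shuffle m (M * ℓ) r)) (^-distribˡ-+-* e (m + r) (M * ℓ)) ⟩
    e ^ (m + r) * e ^ (M * ℓ)                     ≤⟨ *-monoˡ-≤ (e ^ (M * ℓ)) (≤-trans (^-monoˡ-≤ (m + r) (n≤1+n e)) (^-monoʳ-≤ (suc e) (+-monoʳ-≤ m (<⇒≤ r<ℓ)))) ⟩
    C * e ^ (M * ℓ)                               ≤⟨ outgrows C e (M * ℓ) (≤-trans C*e<M (m≤m*n M ℓ)) ⟩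
    suc e ^ (M * ℓ)                               ≤⟨ ^-monoˡ-≤ (M * ℓ) lt ⟩
    (c * b) ^ (M * ℓ)                             ≡⟨ trans (^-distribʳ-* c b (M * ℓ)) (cong (_* b ^ (M * ℓ)) (pow c)) ⟩
    (c ^ ℓ) ^ M * b ^ (M * ℓ)                     ≤⟨ *-monoˡ-≤ (b ^ (M * ℓ)) (^-monoˡ-≤ M hW) ⟩
    (W * 100 ^ ℓ) ^ M * b ^ (M * ℓ)               ≡⟨ cong (_* b ^ (M * ℓ)) (trans (^-distribʳ-* W (100 ^ ℓ) M) (cong (W ^ M *_) (sym (pow 100)))) ⟩
    W ^ M * 100 ^ (M * ℓ) * b ^ (M * ℓ)           ≡⟨ l (W ^ M) (100 ^ (M * ℓ)) (b ^ (M * ℓ)) ⟩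
    W ^ M * b ^ (M * ℓ) * 100 ^ (M * ℓ)           ≤⟨ *-mono-≤ (*-mono-≤ (≤-trans (blockCount^≤S d m M r) (≤-reflexive (cong (λ k → S k q12453) (sym n≡))))
                                                       (^-monoʳ-≤ b Mℓ≤n)) (^-monoʳ-≤ 100 Mℓ≤n) ⟩
    S n q12453 * b ^ n * 100 ^ n                  ∎)
    where
    open ≤-Reasoning
    M = (n ∸ m) / ℓ
    r = (n ∸ m) % ℓ
    r<ℓ : r < ℓ
    r<ℓ = m%n<n (n ∸ m) ℓ
    n≡ : n ≡ m + (M * ℓ + r)
    n≡ = trans (sym (m+[n∸m]≡n (m+n≤o⇒m≤o m N≤n))) (cong (m +_) (trans (m≡m%n+[m/n]*n (n ∸ m) ℓ) (+-comm r (M * ℓ))))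
    C*e<M : C * e < M
    C*e<M = subst (_≤ M) (m*n/n≡m (suc (C * e)) ℓ) (/-monoˡ-≤ ℓ (m+n≤o⇒m≤o∸n (suc (C * e) * ℓ) (subst (_≤ n) (+-comm m _) N≤n)))
    Mℓ≤n : M * ℓ ≤ n
    Mℓ≤n = subst (M * ℓ ≤_) (sym n≡) (≤-trans (m≤m+n (M * ℓ) r) (m≤n+m _ m))
    pow : ∀ z → z ^ (M * ℓ) ≡ (z ^ ℓ) ^ M
    pow z = trans (cong (z ^_) (*-comm M ℓ)) (sym (^-*-assoc z ℓ M))
    shuffle : ∀ m x r → m + (x + r) ≡ (m + r) + x
    shuffle = solve-∀
    l : ∀ w h b → w * h * b ≡ w * b * h
    l = solve-∀

-- For the closing numerical check: factorials evaluate quickly, the recursion of `paths` at C(340,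
-- 89) does not.
paths-! : ∀ i a → paths i a * (i ! * a !) ≡ (i + a) !
paths-! zero    a       = trans (+-identityʳ _) (+-identityʳ _)
paths-! (suc i) zero    = trans (+-identityʳ _) (trans (*-identityʳ (suc i !)) (cong _! (sym (+-identityʳ (suc i)))))
paths-! (suc i) (suc a) = begin
  (paths i (suc a) + paths (suc i) a) * (suc i ! * suc a !)
    ≡⟨ l i a (paths i (suc a)) (paths (suc i) a) (i !) (a !) ⟩
  suc i * (paths i (suc a) * (i ! * suc a !)) + suc a * (paths (suc i) a * (suc i ! * a !))
    ≡⟨ cong₂ (λ x y → suc i * x + suc a * y) (paths-! i (suc a)) (paths-! (suc i) a) ⟩
  suc i * (i + suc a) ! + suc a * (suc i + a) !
    ≡⟨ cong (λ j → suc i * j ! + suc a * (suc i + a) !) (+-suc i a) ⟩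
  suc i * (suc i + a) ! + suc a * (suc i + a) !
    ≡⟨ sym (*-distribʳ-+ ((suc i + a) !) (suc i) (suc a)) ⟩
  (suc i + suc a) * (suc i + a) !
    ≡⟨ cong (λ j → (suc i + suc a) * j !) (sym (+-suc i a)) ⟩
  (suc i + suc a) ! ∎
  where
  open ≡-Reasoning
  l : ∀ i a p q x y → (p + q) * ((x + i * x) * (y + a * y)) ≡ suc i * (p * (x * (y + a * y))) + suc a * (q * ((x + i * x) * y))
  l = solve-∀

multisets-suc : ∀ i e → multisets i (suc e) ≡ paths i e
multisets-suc zero    e       = refl
multisets-suc (suc i) zero    = trans (+-identityʳ _) (trans (multisets-suc i 0) (paths-zero i))
  where
  paths-zero : ∀ i → paths i 0 ≡ 1
  paths-zero zero    = refl
  paths-zero (suc i) = refl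
multisets-suc (suc i) (suc e) = cong₂ _+_ (multisets-suc i (suc e)) (multisets-suc (suc i) e)

binomial-bound : ∀ d m {A B C} → A * (d ! * suc m ! * (d ! * m !)) ≤ (d + suc m) ! * (d + m) ! * B * C →
  A ≤ paths d (suc m) * multisets d (suc m) * B * C
binomial-bound d m {A} {B} {C} h = *-cancelʳ-≤ A _ (f * g) {{m*n≢0 f g {{factorials≢0 d (suc m)}} {{factorials≢0 d m}}}} (begin
  A * (f * g)                                             ≤⟨ h ⟩
  (d + suc m) ! * (d + m) ! * B * C                       ≡⟨ sym (cong₂ (λ x y → x * y * B * C) (paths-! d (suc m)) (paths-! d m)) ⟩
  paths d (suc m) * f * (paths d m * g) * B * C           ≡⟨ l (paths d (suc m)) (paths d m) f g B C ⟩
  paths d (suc m) * paths d m * B * C * (f * g)           ≡⟨ cong (λ x → paths d (suc m) * x * B * C * (f * g)) (sym (multisets-suc d m)) ⟩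
  paths d (suc m) * multisets d (suc m) * B * C * (f * g) ∎)
  where
  open ≤-Reasoning
  f = d ! * suc m !
  g = d ! * m !
  factorials≢0 : ∀ i j → NonZero (i ! * j !)
  factorials≢0 i j = m*n≢0 (i !) (j !) {{>-nonZero (1≤n! i)}} {{>-nonZero (1≤n! j)}}
  l : ∀ p q f g B C → p * f * (q * g) * B * C ≡ p * q * B * C * (f * g)
  l = solve-∀

L≥-from-growth : ∀ {u v c d m} {{_ : NonZero v}} → (∃ λ n → u ^ suc n ≤ v ^ suc n * Z (suc n) []) →
  v ^ suc m * c ^ (d + suc m) * (d ! * suc m ! * (d ! * m !)) ≤ (d + suc m) ! * (d + m) ! * u ^ suc m * 100 ^ (d + suc m) →
  L≥centi q12453 c
L≥-from-growth {u} {v} {c} {d} {m} (n , hZ) h = L≥ c (suc n * d) (suc n * suc m) {{length≢0}}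
  (blockCount-growth {u} {v} {n} hZ {c} {100} {d} {suc m} (binomial-bound d m h))
  where
  length≢0 : NonZero (suc n * d + suc n * suc m)
  length≢0 = >-nonZero (≤-trans (s≤s z≤n) (m≤n+m (suc n * suc m) (suc n * d)))

-- 89 : 251 is close to 1 : √8, the ratio d : m that maximises C(d + m, d)² 8ᵐ for given d + m.
theorem3p6 : L≥centi q12453 1412 × L≤centi q12453 1466
theorem3p6 = L≥-from-growth {39} {5} {1412} {89} {250} Z-growth (≤ᵇ⇒≤ _ _ _) , L≤1466
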